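{- Let $f(x)$ be a separable polynomial of degree $d$ over a discretely valued field $K$ with a fixed labelling $x_1,\dots,x_d$ of its roots, and let $n$ be an integer with $0\le n\le k_f-1$. Let $G\in\mathcal{G}_{n+1}(f)$ satisfy $A_{n+1}(G,f)=\max_{H\in\mathcal{G}_{n+1}(f)}A_{n+1}(H,f)$, where $G$ has the most edges among all graphs in $\mathcal{G}_{n+1}(f)$ attaining this maximum. Then $G_{n+1}(f)=G$ (as unlabelled weighted graphs) and $d_{n+1}(f)=A_{n+1}(G,f)$.
   Context: $\textup{ord}$ is the normalised valuation of $K$, extended to $\bar K$, with $\textup{ord}(0)=\infty$. $d_n(f)$ is the $n$-th largest value of $\{\textup{ord}(x_i-x_j):i<j\}$, $k_f$ the number of distinct such values, $e_n(f)=\#\{\{i,j\}:i<j,\ \textup{ord}(x_i-x_j)=d_n(f)\}$. Weighted graphs $G=(V,E,w)$ on $V=\{v_1,\dots,v_d\}$ with $w:E\to\mathbb{Z}_{\ge0}$ (non-edges weight $0$); $|E_G|$ is the number of edges. $S_d$ acts by permuting vertices: $\sigma(E)=\{v_{\sigma(i)}v_{\sigma(j)}:v_iv_j\in E\}$, $\sigma(w)(v_{\sigma(i)}v_{\sigma(j)})=w(v_iv_j)$. $J_G=\sum_{\sigma\in S_d/\mathrm{Stab}_{S_d}(G)}1/\prod_{v_iv_j\in\sigma(E)}(X_i-X_j)^{2\sigma(w)(v_iv_j)}$, $J_{G,f}=J_G(x_1,\dots,x_d)$. $\mathbf{G}_d$: weighted graphs on $d$ vertices with $w$ surjective onto $\{1,\dots,m\}$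 for some $m\ge1$ and $w(v_1v_2)\ge\min(w(v_2v_3),w(v_1v_3))$ for all vertices. $G_n(f)=(V,E_n,w_n)$ for $1\le n\le k_f$: $v_i\leftrightarrow x_i$, $E_n=\{v_iv_j:\textup{ord}(x_i-x_j)\ge d_n(f)\}$, $w_n(v_iv_j)=n+1-m$ if $\textup{ord}(x_i-x_j)=d_m(f)$; $G_0(f)$ is the empty graph. $G_n'(f)=(V,E_n,w_n')$ with $w_n'(v_iv_j)=n+2-m$ if $\textup{ord}(x_i-x_j)=d_m(f)$. $\mathcal{G}_{n+1}(f)$: the set of $H=(V,E,w)\in\mathbf{G}_d$ with $E\supsetneq E_n$, $w=w_n'$ on $E_n$, $w=1$ on $E\setminus E_n$, and $E$ transitively closed ($v_iv_j,v_jv_k\in E\Rightarrow v_iv_k\in E$ for distinct $i,j,k$). $A_{n+1}(H,f)=\dfrac{ -\textup{ord}(J_{H,f})-2\sum_{l=1}^{n}e_l(f)(n+2-l)d_l(f)}{2(|E_H|-|E_{G_n(f)}|)}$, with $A_{n+1}(H,f)=-\infty$ if $J_{H,f}=0$. -}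

module Defs where

open import Data.Nat as N using (ℕ; zero; suc; _∸_; _⊓_)
import Data.Nat.Properties as NP
open import Data.Integer as Z using (ℤ; +_)
open import Data.Rational as Q using (ℚ; 0ℚ; 1ℚ)
import Data.Rational.Properties as QP
open import Data.Fin as F using (Fin; toℕ)
import Data.Fin.Properties as FP
open import Data.Fin.Permutation using (Permutation′; _⟨$⟩ʳ_)
open import Data.Maybe using (Maybe; just; nothing)
open import Data.List as L using (List; []; _∷_; _++_; [_]; length; map; foldr; filter; filterᵇ; concatMap; deduplicate; allFin; head)
open import Data.Vec as V using (Vec; tabulate; lookup)
import Data.Vec.Properties as VP
import Data.Bool
open import Data.Bool using (Bool; true; false; _∨_; not)
open import Data.Product using (Σ; ∃; _×_; _,_; proj₁; proj₂)
open import Data.Sum using (_⊎_)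
open import Data.Empty using (⊥)
open import Data.Unit using (⊤)
open import Relation.Nullary using (¬_; does)
open import Relation.Binary.PropositionalEquality using (_≡_; _≢_)
open import Algebra.Structures using (IsCommutativeRing)

record Field : Set₁ where
  infixl 6 _+_
  infixl 7 _*_
  field
    Carrier : Set
    _+_ _*_ : Carrier → Carrier → Carrier
    -_ : Carrier → Carrier
    0# 1# : Carrier
    _⁻¹ : Carrier → Carrier
    isCommutativeRing : IsCommutativeRing _≡_ _+_ _*_ -_ 0# 1#
    0≢1 : 0# ≢ 1#
    inverseʳ : ∀ x → x ≢ 0# → x * (x ⁻¹) ≡ 1#

  _-_ : Carrier → Carrier → Carrier
  x - y = x + (- y)

  _^_ : Carrier → ℕ → Carrier
  x ^ zero = 1#
  x ^ suc k = x * (x ^ k)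

  -- polynomials as coefficient lists, constant term first
  eval : List Carrier → Carrier → Carrier
  eval [] x = 0#
  eval (c ∷ cs) x = c + x * eval cs x

  HasDegree : List Carrier → ℕ → Set
  HasDegree p d = Σ (List Carrier) λ cs → Σ Carrier λ a →
    (p ≡ cs ++ [ a ]) × (a ≢ 0#) × (length cs ≡ d)

  prod : List Carrier → Carrier
  prod = foldr _*_ 1#

  sumF : List Carrier → Carrier
  sumF = foldr _+_ 0#

open Field public using (Carrier)

ℚ∞ : Set
ℚ∞ = Maybe ℚ

_≤∞_ : ℚ∞ → ℚ∞ → Set
_ ≤∞ nothing = ⊤
nothing ≤∞ just _ = ⊥
just a ≤∞ just b = a Q.≤ b

min∞ : ℚ∞ → ℚ∞ → ℚ∞
min∞ nothing b = b
min∞ (just a) nothing = just a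
min∞ (just a) (just b) = just (a Q.⊓ b)

_+∞_ : ℚ∞ → ℚ∞ → ℚ∞
nothing +∞ _ = nothing
just _ +∞ nothing = nothing
just a +∞ just b = just (a Q.+ b)

record Setting : Set₁ where
  field
    K Kbar : Field
  open Field K using () renaming (_+_ to _+K_; _*_ to _*K_; 1# to 1K; 0# to 0K)
  open Field Kbar using () renaming (_+_ to _+L_; _*_ to _*L_; 1# to 1L; 0# to 0L)
  field
    ι : Carrier K → Carrier Kbar
    ι-+ : ∀ a b → ι (a +K b) ≡ ι a +L ι b
    ι-* : ∀ a b → ι (a *K b) ≡ ι a *L ι b
    ι-1 : ι 1K ≡ 1L
    algClosed : ∀ (p : List (Carrier Kbar)) (n : ℕ) → Field.HasDegree Kbar p (suc n) →
      ∃ λ y → Field.eval Kbar p y ≡ 0L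
    algebraic : ∀ y → Σ (List (Carrier K)) λ p → Σ ℕ λ n →
      Field.HasDegree K p n × (Field.eval Kbar (map ι p) y ≡ 0L)
    ord : Carrier Kbar → ℚ∞
    ord-∞ : ∀ y → ord y ≡ nothing → y ≡ 0L
    ord-0 : ord 0L ≡ nothing
    ord-* : ∀ y z → ord (y *L z) ≡ ord y +∞ ord z
    ord-+ : ∀ y z → min∞ (ord y) (ord z) ≤∞ ord (y +L z)
    ord-discrete : ∀ a → (ord (ι a) ≡ nothing) ⊎ (∃ λ (z : ℤ) → ord (ι a) ≡ just (z Q./ 1))
    ord-normalised : ∃ λ π → ord (ι π) ≡ just 1ℚ

-- Weighted graphs on vertices Fin d: weight function, non-edges weight 0,
-- edges = pairs with positive weight.

record WGraph (d : ℕ) : Set where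
  field
    w : Fin d → Fin d → ℕ
    w-sym : ∀ i j → w i j ≡ w j i
    w-diag : ∀ i → w i i ≡ 0
open WGraph public

pairs : (d : ℕ) → List (Fin d × Fin d)
pairs d = concatMap (λ i → map (λ j → (i , j)) (filter (λ j → i F.<? j) (allFin d))) (allFin d)

numEdges : ∀ {d} → (Fin d → Fin d → ℕ) → ℕ
numEdges {d} w = length (filterᵇ (λ p → N._<ᵇ_ 0 (w (proj₁ p) (proj₂ p))) (pairs d))

InBoldG : ∀ {d} → WGraph d → Set
InBoldG {d} G =
  (Σ ℕ λ m → (1 N.≤ m) × (∀ i j → w G i j N.≤ m) ×
     (∀ k → 1 N.≤ k → k N.≤ m → ∃ λ i → ∃ λ j → w G i j ≡ k))
  × (∀ i j k → i ≢ j → j ≢ k → i ≢ k → (w G j k ⊓ w G i k) N.≤ w G i j)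

allVecs : (d m : ℕ) → List (Vec (Fin d) m)
allVecs d zero = V.[] ∷ []
allVecs d (suc m) = concatMap (λ i → map (i V.∷_) (allVecs d m)) (allFin d)

allᵇ : {A : Set} → (A → Bool) → List A → Bool
allᵇ p [] = true
allᵇ p (a ∷ as) = Data.Bool._∧_ (p a) (allᵇ p as)

injᵇ : ∀ {d} → Vec (Fin d) d → Bool
injᵇ {d} v = allᵇ (λ a → allᵇ (λ b → does (a F.≟ b) ∨ not (does (lookup v a F.≟ lookup v b))) (allFin d)) (allFin d)

perms : (d : ℕ) → List (Vec (Fin d) d)
perms d = filterᵇ injᵇ (allVecs d d)

orbit : ∀ {d} → (Fin d → Fin d → ℕ) → List (Vec (Vec ℕ d) d)
orbit {d} w = deduplicate (VP.≡-dec (VP.≡-dec N._≟_))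
  (map (λ π → tabulate (λ a → tabulate (λ b → w (lookup π a) (lookup π b)))) (perms d))

module Roots (S : Setting) {d : ℕ} (x : Fin d → Carrier (Setting.Kbar S)) where
  open Setting S
  open Field Kbar using (_⁻¹; _^_; _-_; prod; sumF)

  -- value in ℚ (the junk value 0 for ∞ never occurs for distinct roots)
  toℚ : ℚ∞ → ℚ
  toℚ nothing = 0ℚ
  toℚ (just q) = q

  v : Fin d → Fin d → ℚ
  v i j = toℚ (ord (x i - x j))

  D : List ℚ
  D = deduplicate QP._≟_ (map (λ p → v (proj₁ p) (proj₂ p)) (pairs d))

  k : ℕ
  k = length D

  rank : ℚ → ℕ
  rank q = suc (length (filter (λ r → q QP.<? r) D))

  -- d_n (junk 0 if n out of range)
  dd : ℕ → ℚ
  dd n with head (filter (λ r → rank r N.≟ n) D)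
  ... | just r = r
  ... | nothing = 0ℚ

  e : ℕ → ℕ
  e n = length (filter (λ p → rank (v (proj₁ p) (proj₂ p)) N.≟ n) (pairs d))

  -- E_n : ord(x_i - x_j) ≥ d_n(f), i.e. rank ≤ n
  inE : ℕ → Fin d → Fin d → Set
  inE n i j = (i ≢ j) × (rank (v i j) N.≤ n)

  wG : ℕ → Fin d → Fin d → ℕ
  wG n i j with i F.≟ j | rank (v i j) N.≤? n
  ... | Relation.Nullary.yes _ | _ = 0
  ... | Relation.Nullary.no _ | Relation.Nullary.yes _ = suc n ∸ rank (v i j)
  ... | Relation.Nullary.no _ | Relation.Nullary.no _ = 0

  wG' : ℕ → Fin d → Fin d → ℕ
  wG' n i j with i F.≟ j | rank (v i j) N.≤? n
  ... | Relation.Nullary.yes _ | _ = 0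
  ... | Relation.Nullary.no _ | Relation.Nullary.yes _ = suc (suc n) ∸ rank (v i j)
  ... | Relation.Nullary.no _ | Relation.Nullary.no _ = 0

  InCalG : ℕ → WGraph d → Set
  InCalG n H =
    InBoldG H
    × (∀ i j → inE n i j → w H i j ≡ wG' n i j)
    × (∀ i j → i ≢ j → ¬ inE n i j → (w H i j ≡ 0) ⊎ (w H i j ≡ 1))
    × (∃ λ i → ∃ λ j → i ≢ j × ¬ inE n i j × (w H i j ≡ 1))
    × (∀ i j l → i ≢ j → j ≢ l → i ≢ l → 0 N.< w H i j → 0 N.< w H j l → 0 N.< w H i l)

  term : Vec (Vec ℕ d) d → Carrier Kbar
  term M = (prod (map (λ p → (x (proj₁ p) - x (proj₂ p)) ^ (2 N.* lookup (lookup M (proj₁ p)) (proj₂ p))) (pairs d))) ⁻¹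

  J : WGraph d → Carrier Kbar
  J G = sumF (map term (orbit (w G)))

  -- q / m in ℚ (junk 0 for m = 0)
  divℕ : ℚ → ℕ → ℚ
  divℕ q zero = 0ℚ
  divℕ q (suc m) = q Q.* (+ 1 Q./ suc m)

  sumℚ : List ℚ → ℚ
  sumℚ = foldr Q._+_ 0ℚ

  -- A_{n+1}(H,f) ∈ ℚ ∪ {-∞}, with nothing = -∞
  A : ℕ → WGraph d → Maybe ℚ
  A n H with ord (J H)
  ... | nothing = nothing
  ... | just o = just (divℕ (Q.- o Q.- (+ 2 Q./ 1) Q.* S')
                            (2 N.* (numEdges (w H) ∸ numEdges (wG n))))
    where
    S' : ℚ
    S' = sumℚ (map (λ l → ((+ (e l N.* (suc (suc n) ∸ l))) Q./ 1) Q.* dd l) (map suc (L.upTo n)))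

_≤-∞_ : Maybe ℚ → Maybe ℚ → Set
nothing ≤-∞ _ = ⊤
just _ ≤-∞ nothing = ⊥
just a ≤-∞ just b = a Q.≤ b

{-# OPTIONS --safe #-}
module Submission where

open import Defs
open import Data.Nat using (ℕ; suc; _<_; _≤_)
open import Data.Rational using (ℚ)
open import Data.Maybe using (just)
open import Data.Fin using (Fin)
open import Data.Fin.Permutation using (Permutation′; _⟨$⟩ʳ_)
open import Data.Product using (Σ; ∃; _×_)
open import Data.List using (map)
open import Relation.Binary.PropositionalEquality using (_≡_)

open import Data.Nat using (zero; s≤s; z≤n; _∸_)
import Data.Nat as ℕ
import Data.Nat.Properties as ℕₚ
import Data.Integer as ℤ
import Data.Integer.Properties as ℤₚ
open import Data.Rational using (0ℚ; 1ℚ)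
import Data.Rational as ℚ
import Data.Rational.Properties as ℚₚ
import Data.Rational.Unnormalised as ℚᵘ
import Data.Rational.Unnormalised.Properties as ℚᵘₚ
open import Data.Rational.Solver using (module +-*-Solver)
open import Data.Bool using (Bool; true; if_then_else_; not; _∧_; _∨_)
open import Data.Bool.Properties using (T-≡; T?)
open import Data.Empty using (⊥-elim)
open import Data.Unit using (⊤; tt)
open import Data.Maybe using (nothing)
open import Data.Maybe.Properties using (just-injective)
open import Data.Fin.Permutation using (permutation)
open import Data.Product using (_,_; proj₁; proj₂; uncurry)
open import Data.Sum using (_⊎_; inj₁; inj₂)
import Data.Fin as Fin
import Data.Fin.Properties as Finₚ
import Data.Fin.Permutation as Perm
open import Data.List using (List; []; _∷_; _++_; foldr; filter; concatMap; length; lookup; upTo; allFin; tabulate)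
open import Data.List.Properties using (filter-notAll)
open import Data.List.Membership.Propositional using (_∈_; find; lose)
open import Data.List.Membership.Propositional.Properties
import Data.List.Relation.Unary.All as All
import Data.List.Relation.Unary.Any as Any
open import Data.List.Relation.Unary.Any using (here; there)
open import Data.List.Relation.Unary.AllPairs using () renaming (_∷_ to _∷ᵘ_)
open import Data.List.Relation.Unary.Unique.Propositional using (Unique)
import Data.List.Relation.Unary.Unique.Propositional.Properties as Uniqueₚ
import Data.List.Relation.Unary.Unique.DecPropositional.Properties as DecUnique
open import Data.Vec as Vec using (Vec)
import Data.Vec.Properties as Vecₚ
open import Function using (_∘_; id)
open import Function.Bundles using (Equivalence)
open import Function.Definitions using (Injective)
open import Relation.Nullary using (¬_; Dec; yes; no; does; contradiction)
open import Relation.Binary using (tri<; tri≈; tri>)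
open import Relation.Binary.PropositionalEquality
  using (_≢_; refl; sym; trans; cong; cong₂; subst; subst₂; module ≡-Reasoning)
open import Algebra.Bundles using (CommutativeRing)
import Algebra.Properties.Ring
import Algebra.Properties.CommutativeMonoid.Sum ℚₚ.+-0-commutativeMonoid as Table

open +-*-Solver using (solve; _:+_; _:*_; :-_; _:=_; con)

-- The valuation of a term of J_H is -2 times the value Σ w(ij) ord(x_i - x_j) of a relabelling of H,
-- so -ord(J_H) is at most twice the largest such value. By the rearrangement inequality that value is
-- at most Σ_{l ≤ n} e_l (n+2-l) d_l + (|E_H| - |E_n|) d_{n+1}, which says A_{n+1}(H, f) ≤ d_{n+1}.
-- The inequality is proved edge by edge: subtracting from each edge a cost that depends only on its
-- weight does not affect the comparison of relabellings, and the cost can be chosen so that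
-- G_{n+1}(f) gives every edge the largest weight among those maximising weight times valuation minus
-- cost. For H = G_{n+1}(f) the optimal relabelling is therefore unique, J_H has a single dominant term,
-- and A_{n+1}(H, f) = d_{n+1}. A maximiser with at least as many edges as G_{n+1}(f) has a relabelling
-- whose weights are bounded by those of G_{n+1}(f) with at least the same total, hence equal to them.

-- Rational arithmetic

fromℕ : ℕ → ℚ
fromℕ m = (ℤ.+ m) ℚ./ 1

fromℕ-+ : ∀ m n → fromℕ (m ℕ.+ n) ≡ fromℕ m ℚ.+ fromℕ n
fromℕ-+ m n = ℚₚ.toℚᵘ-injective (begin
  ℚ.toℚᵘ (fromℕ (m ℕ.+ n))                  ≈⟨ ℚₚ.toℚᵘ-fromℚᵘ (ℚᵘ.mkℚᵘ (ℤ.+ (m ℕ.+ n)) 0) ⟩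
  ℚᵘ.mkℚᵘ (ℤ.+ (m ℕ.+ n)) 0                 ≈⟨ ℚᵘ.*≡* (cong (ℤ._* ℤ.+ 1) (sym (cong₂ ℤ._+_ (ℤₚ.*-identityʳ (ℤ.+ m)) (ℤₚ.*-identityʳ (ℤ.+ n))))) ⟩
  ℚᵘ.mkℚᵘ (ℤ.+ m) 0 ℚᵘ.+ ℚᵘ.mkℚᵘ (ℤ.+ n) 0  ≈⟨ ℚᵘₚ.+-cong (ℚₚ.toℚᵘ-fromℚᵘ (ℚᵘ.mkℚᵘ (ℤ.+ m) 0)) (ℚₚ.toℚᵘ-fromℚᵘ (ℚᵘ.mkℚᵘ (ℤ.+ n) 0)) ⟨
  ℚ.toℚᵘ (fromℕ m) ℚᵘ.+ ℚ.toℚᵘ (fromℕ n)    ≈⟨ ℚₚ.toℚᵘ-homo-+ (fromℕ m) (fromℕ n) ⟨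
  ℚ.toℚᵘ (fromℕ m ℚ.+ fromℕ n)              ∎)
  where open ℚᵘₚ.≃-Reasoning

fromℕ-suc-* : ∀ m q → fromℕ (suc m) ℚ.* q ≡ q ℚ.+ fromℕ m ℚ.* q
fromℕ-suc-* m q = trans (cong (ℚ._* q) (fromℕ-+ 1 m))
  (trans (ℚₚ.*-distribʳ-+ q 1ℚ (fromℕ m)) (cong (ℚ._+ fromℕ m ℚ.* q) (ℚₚ.*-identityˡ q)))

fromℕ-suc*1/ : ∀ m → fromℕ (suc m) ℚ.* ((ℤ.+ 1) ℚ./ suc m) ≡ 1ℚ
fromℕ-suc*1/ m = ℚₚ.toℚᵘ-injective (begin
  ℚ.toℚᵘ (fromℕ (suc m) ℚ.* ((ℤ.+ 1) ℚ./ suc m))          ≈⟨ ℚₚ.toℚᵘ-homo-* (fromℕ (suc m)) ((ℤ.+ 1) ℚ./ suc m) ⟩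
  ℚ.toℚᵘ (fromℕ (suc m)) ℚᵘ.* ℚ.toℚᵘ ((ℤ.+ 1) ℚ./ suc m)  ≈⟨ ℚᵘₚ.*-cong (ℚₚ.toℚᵘ-fromℚᵘ (ℚᵘ.mkℚᵘ (ℤ.+ suc m) 0)) (ℚₚ.toℚᵘ-fromℚᵘ (ℚᵘ.mkℚᵘ (ℤ.+ 1) m)) ⟩
  ℚᵘ.mkℚᵘ (ℤ.+ suc m) 0 ℚᵘ.* ℚᵘ.mkℚᵘ (ℤ.+ 1) m            ≈⟨ ℚᵘ.*≡* (cong ℤ.+_ (cong suc (eq m))) ⟩
  ℚ.toℚᵘ 1ℚ                                               ∎)
  where
  open ℚᵘₚ.≃-Reasoning
  eq : ∀ m → (m ℕ.* 1) ℕ.* 1 ≡ m ℕ.+ 0 ℕ.+ 0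
  eq m = trans (ℕₚ.*-identityʳ _) (trans (ℕₚ.*-identityʳ m)
    (sym (trans (ℕₚ.+-identityʳ _) (ℕₚ.+-identityʳ m))))

fromℕ-mono-≤ : ∀ {m n} → m ≤ n → fromℕ m ℚ.≤ fromℕ n
fromℕ-mono-≤ {m} {n} m≤n = ℚₚ.toℚᵘ-cancel-≤
  (ℚᵘₚ.≤-respˡ-≃ (ℚᵘₚ.≃-sym (ℚₚ.toℚᵘ-fromℚᵘ (ℚᵘ.mkℚᵘ (ℤ.+ m) 0)))
  (ℚᵘₚ.≤-respʳ-≃ (ℚᵘₚ.≃-sym (ℚₚ.toℚᵘ-fromℚᵘ (ℚᵘ.mkℚᵘ (ℤ.+ n) 0)))
  (ℚᵘ.*≤* (ℤₚ.*-monoʳ-≤-nonNeg (ℤ.+ 1) (ℤ.+≤+ m≤n)))))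

fromℕ-cancel-≤ : ∀ {m n} → fromℕ m ℚ.≤ fromℕ n → m ≤ n
fromℕ-cancel-≤ {m} {n} m≤n = ℤₚ.drop‿+≤+ (subst₂ ℤ._≤_ (ℤₚ.*-identityʳ (ℤ.+ m)) (ℤₚ.*-identityʳ (ℤ.+ n))
  (ℚᵘₚ.drop-*≤*
  (ℚᵘₚ.≤-respˡ-≃ (ℚₚ.toℚᵘ-fromℚᵘ (ℚᵘ.mkℚᵘ (ℤ.+ m) 0))
  (ℚᵘₚ.≤-respʳ-≃ (ℚₚ.toℚᵘ-fromℚᵘ (ℚᵘ.mkℚᵘ (ℤ.+ n) 0)) (ℚₚ.toℚᵘ-mono-≤ m≤n)))))

fromℕ-injective : ∀ {m n} → fromℕ m ≡ fromℕ n → m ≡ n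
fromℕ-injective eq = ℕₚ.≤-antisym (fromℕ-cancel-≤ (ℚₚ.≤-reflexive eq)) (fromℕ-cancel-≤ (ℚₚ.≤-reflexive (sym eq)))

fromℕ-* : ∀ m n → fromℕ (m ℕ.* n) ≡ fromℕ m ℚ.* fromℕ n
fromℕ-* zero n = sym (ℚₚ.*-zeroˡ (fromℕ n))
fromℕ-* (suc m) n = trans (fromℕ-+ n (m ℕ.* n))
  (trans (cong (fromℕ n ℚ.+_) (fromℕ-* m n)) (sym (fromℕ-suc-* m (fromℕ n))))

fromℕ-∸ : ∀ {m n} → n ≤ m → fromℕ (m ∸ n) ≡ fromℕ m ℚ.+ ℚ.- fromℕ n
fromℕ-∸ {m} {n} n≤m = trans (solve 2 (λ a b → a := (a :+ b) :+ :- b) refl (fromℕ (m ∸ n)) (fromℕ n))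
  (cong (ℚ._+ ℚ.- fromℕ n) (trans (sym (fromℕ-+ (m ∸ n) n)) (cong fromℕ (ℕₚ.m∸n+n≡m n≤m))))

fromℕ-positive : ∀ {m} → 0 < m → ℚ.Positive (fromℕ m)
fromℕ-positive 0<m = ℚ.positive (ℚₚ.≰⇒> λ m≤0 → ℕₚ.<⇒≱ 0<m (fromℕ-cancel-≤ {n = 0} m≤0))

neg-involutive : ∀ q → ℚ.- (ℚ.- q) ≡ q
neg-involutive = solve 1 (λ q → :- (:- q) := q) refl

-- Doubled quantities occur twice: sums over ordered pairs count every pair twice, and the terms of
-- J carry the exponent 2w.
+-double-cancel-≤ : ∀ {p q} → p ℚ.+ p ℚ.≤ q ℚ.+ q → p ℚ.≤ q
+-double-cancel-≤ le = ℚₚ.≮⇒≥ λ q<p → ℚₚ.<-irrefl refl (ℚₚ.<-≤-trans (ℚₚ.+-mono-< q<p q<p) le)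

+-double-injective : ∀ {p q} → p ℚ.+ p ≡ q ℚ.+ q → p ≡ q
+-double-injective eq = ℚₚ.≤-antisym (+-double-cancel-≤ (ℚₚ.≤-reflexive eq)) (+-double-cancel-≤ (ℚₚ.≤-reflexive (sym eq)))

+-cancelˡ-≤ : ∀ r {p q} → r ℚ.+ p ℚ.≤ r ℚ.+ q → p ℚ.≤ q
+-cancelˡ-≤ r le = ℚₚ.≮⇒≥ λ q<p → ℚₚ.<-irrefl refl (ℚₚ.<-≤-trans (ℚₚ.+-monoʳ-< r q<p) le)

+-cancelʳ-≤ : ∀ r {p q} → p ℚ.+ r ℚ.≤ q ℚ.+ r → p ℚ.≤ q
+-cancelʳ-≤ r {p} {q} le = +-cancelˡ-≤ r (subst₂ ℚ._≤_ (ℚₚ.+-comm p r) (ℚₚ.+-comm q r) le)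

-- Sums over lists

∑ : {A : Set} → (A → ℚ) → List A → ℚ
∑ g xs = foldr ℚ._+_ 0ℚ (map g xs)

indicator : {P : Set} → Dec P → ℚ
indicator P? = if does P? then 1ℚ else 0ℚ

indicator-yes : {P : Set} (P? : Dec P) → P → ∀ q → indicator P? ℚ.* q ≡ q
indicator-yes (yes _) _ q = ℚₚ.*-identityˡ q
indicator-yes (no ¬p) p q = contradiction p ¬p

indicator-no : {P : Set} (P? : Dec P) → ¬ P → ∀ q → indicator P? ℚ.* q ≡ 0ℚ
indicator-no (yes p) ¬p q = contradiction p ¬p
indicator-no (no _) _ q = ℚₚ.*-zeroˡ q

module _ {A : Set} where

  ∑-cong : ∀ {g h : A → ℚ} xs → (∀ {a} → a ∈ xs → g a ≡ h a) → ∑ g xs ≡ ∑ h xs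
  ∑-cong [] _ = refl
  ∑-cong (a ∷ xs) eq = cong₂ ℚ._+_ (eq (here refl)) (∑-cong xs (eq ∘ there))

  ∑-zero : ∀ (xs : List A) → ∑ (λ _ → 0ℚ) xs ≡ 0ℚ
  ∑-zero [] = refl
  ∑-zero (_ ∷ xs) = trans (ℚₚ.+-identityˡ _) (∑-zero xs)

  ∑-+ : ∀ (g h : A → ℚ) xs → ∑ (λ a → g a ℚ.+ h a) xs ≡ ∑ g xs ℚ.+ ∑ h xs
  ∑-+ g h [] = refl
  ∑-+ g h (a ∷ xs) = trans (cong ((g a ℚ.+ h a) ℚ.+_) (∑-+ g h xs))
    (solve 4 (λ a b c d → (a :+ b) :+ (c :+ d) := (a :+ c) :+ (b :+ d)) refl (g a) (h a) (∑ g xs) (∑ h xs))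

  ∑-*ʳ : ∀ (g : A → ℚ) c xs → ∑ (λ a → g a ℚ.* c) xs ≡ ∑ g xs ℚ.* c
  ∑-*ʳ g c [] = sym (ℚₚ.*-zeroˡ c)
  ∑-*ʳ g c (a ∷ xs) = trans (cong (g a ℚ.* c ℚ.+_) (∑-*ʳ g c xs)) (sym (ℚₚ.*-distribʳ-+ c (g a) (∑ g xs)))

  ∑-neg : ∀ (g : A → ℚ) xs → ∑ (λ a → ℚ.- g a) xs ≡ ℚ.- ∑ g xs
  ∑-neg g [] = refl
  ∑-neg g (a ∷ xs) = trans (cong (ℚ.- g a ℚ.+_) (∑-neg g xs)) (sym (ℚₚ.neg-distrib-+ (g a) (∑ g xs)))

  ∑-mono-≤ : ∀ {g h : A → ℚ} xs → (∀ {a} → a ∈ xs → g a ℚ.≤ h a) → ∑ g xs ℚ.≤ ∑ h xs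
  ∑-mono-≤ [] _ = ℚₚ.≤-refl
  ∑-mono-≤ (a ∷ xs) le = ℚₚ.+-mono-≤ (le (here refl)) (∑-mono-≤ xs (le ∘ there))

  -- A strict inequality at the head would make the whole sum strict, so the heads agree and can be
  -- cancelled. This turns an equality of totals into equalities edge by edge.
  ∑-≤-tight : ∀ {g h : A → ℚ} xs → (∀ {a} → a ∈ xs → g a ℚ.≤ h a) → ∑ h xs ℚ.≤ ∑ g xs →
    ∀ {a} → a ∈ xs → g a ≡ h a
  ∑-≤-tight {g} {h} (b ∷ xs) le ge a∈xs = case-∈ a∈xs
    where
    head≡ : g b ≡ h b
    head≡ = ℚₚ.≤-antisym (le (here refl)) (ℚₚ.≮⇒≥ λ gb<hb →
      ℚₚ.<-irrefl refl (ℚₚ.<-≤-trans (ℚₚ.+-mono-<-≤ gb<hb (∑-mono-≤ xs (le ∘ there))) ge))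
    tail≤ : ∑ h xs ℚ.≤ ∑ g xs
    tail≤ = +-cancelˡ-≤ (h b) (subst (λ z → h b ℚ.+ ∑ h xs ℚ.≤ z ℚ.+ ∑ g xs) head≡ ge)
    case-∈ : ∀ {a} → a ∈ (b ∷ xs) → g a ≡ h a
    case-∈ (here refl) = head≡
    case-∈ (there a∈xs) = ∑-≤-tight xs (le ∘ there) tail≤ a∈xs

  ∑-++ : ∀ (g : A → ℚ) xs ys → ∑ g (xs ++ ys) ≡ ∑ g xs ℚ.+ ∑ g ys
  ∑-++ g [] ys = sym (ℚₚ.+-identityˡ _)
  ∑-++ g (a ∷ xs) ys = trans (cong (g a ℚ.+_) (∑-++ g xs ys)) (sym (ℚₚ.+-assoc (g a) (∑ g xs) (∑ g ys)))

  -- Writing a restricted sum as a weighted sum over the full list allows the order of summation to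
  -- be exchanged.
  ∑-filter : ∀ {P : A → Set} (P? : ∀ a → Dec (P a)) (g : A → ℚ) xs →
    ∑ g (filter P? xs) ≡ ∑ (λ a → indicator (P? a) ℚ.* g a) xs
  ∑-filter P? g [] = refl
  ∑-filter P? g (a ∷ xs) with P? a
  ... | yes _ = cong₂ ℚ._+_ (sym (ℚₚ.*-identityˡ (g a))) (∑-filter P? g xs)
  ... | no _ = trans (∑-filter P? g xs) (sym (trans (cong (ℚ._+ _) (ℚₚ.*-zeroˡ (g a))) (ℚₚ.+-identityˡ _)))

  length≡∑ : ∀ (xs : List A) → fromℕ (length xs) ≡ ∑ (λ _ → 1ℚ) xs
  length≡∑ [] = refl
  length≡∑ (_ ∷ xs) = trans (fromℕ-+ 1 (length xs)) (cong (1ℚ ℚ.+_) (length≡∑ xs))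

  length-filter≡∑ : ∀ {P : A → Set} (P? : ∀ a → Dec (P a)) xs →
    fromℕ (length (filter P? xs)) ≡ ∑ (λ a → indicator (P? a)) xs
  length-filter≡∑ P? xs = trans (length≡∑ (filter P? xs)) (trans (∑-filter P? (λ _ → 1ℚ) xs)
    (∑-cong xs λ {a} _ → ℚₚ.*-identityʳ (indicator (P? a))))

∑-map : ∀ {A B : Set} (f : A → B) (g : B → ℚ) xs → ∑ g (map f xs) ≡ ∑ (g ∘ f) xs
∑-map f g [] = refl
∑-map f g (a ∷ xs) = cong (g (f a) ℚ.+_) (∑-map f g xs)

∑-concatMap : ∀ {A B : Set} (f : A → List B) (g : B → ℚ) xs →
  ∑ g (concatMap f xs) ≡ ∑ (λ a → ∑ g (f a)) xs
∑-concatMap f g [] = refl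
∑-concatMap f g (a ∷ xs) = trans (∑-++ g (f a) (concatMap f xs)) (cong (∑ g (f a) ℚ.+_) (∑-concatMap f g xs))

∑-comm : ∀ {A B : Set} (g : A → B → ℚ) xs ys →
  ∑ (λ a → ∑ (g a) ys) xs ≡ ∑ (λ b → ∑ (λ a → g a b) xs) ys
∑-comm g [] ys = sym (∑-zero ys)
∑-comm g (a ∷ xs) ys = trans (cong (∑ (g a) ys ℚ.+_) (∑-comm g xs ys)) (sym (∑-+ (g a) (λ b → ∑ (λ a → g a b) xs) ys))

∑-single : ∀ {A : Set} (_≟_ : (a b : A) → Dec (a ≡ b)) {b : A} (g : A → ℚ) xs → Unique xs → b ∈ xs →
  ∑ (λ a → indicator (b ≟ a) ℚ.* g a) xs ≡ g b
∑-single _≟_ {b} g (a ∷ xs) (a∉xs ∷ᵘ _) (here refl) = trans (cong₂ ℚ._+_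
  (indicator-yes (a ≟ a) refl (g a))
  (trans (∑-cong xs λ {c} c∈xs → indicator-no (a ≟ c) (All.lookup a∉xs c∈xs) (g c)) (∑-zero xs)))
  (ℚₚ.+-identityʳ (g a))
∑-single _≟_ {b} g (a ∷ xs) (a∉xs ∷ᵘ u) (there b∈xs) = trans (cong₂ ℚ._+_
  (indicator-no (b ≟ a) (λ b≡a → All.lookup a∉xs b∈xs (sym b≡a)) (g a))
  (∑-single _≟_ g xs u b∈xs)) (ℚₚ.+-identityˡ (g b))

-- Double counting: each element of level l contributes one of the `length (filter ...)` copies of
-- the l-th summand. The summation starts at level 1, hence the positivity of `level`.
∑-by-level : ∀ {A : Set} (level : A → ℕ) (g : A → ℚ) (c : ℕ → ℕ) (f : ℕ → ℚ) n xs →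
  (∀ a → 0 < level a) → (∀ {a} → a ∈ xs → f (level a) ≡ g a) →
  ∑ (λ l → fromℕ (length (filter (λ a → level a ℕ.≟ l) xs) ℕ.* c l) ℚ.* f l) (map suc (upTo n)) ≡
  ∑ (λ a → indicator (level a ℕ.≤? n) ℚ.* (fromℕ (c (level a)) ℚ.* g a)) xs
∑-by-level {A} level g c f n xs 0<level f-level = begin
  ∑ (λ l → fromℕ (size l ℕ.* c l) ℚ.* f l) levels
    ≡⟨ ∑-cong levels (λ {l} _ → expand l) ⟩
  ∑ (λ l → ∑ (λ a → indicator (level a ℕ.≟ l) ℚ.* h l) xs) levels
    ≡⟨ ∑-comm (λ l a → indicator (level a ℕ.≟ l) ℚ.* h l) levels xs ⟩
  ∑ (λ a → ∑ (λ l → indicator (level a ℕ.≟ l) ℚ.* h l) levels) xs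
    ≡⟨ ∑-cong xs (λ {a} a∈xs → trans (collapse (level a) (0<level a))
         (cong (λ z → indicator (level a ℕ.≤? n) ℚ.* (fromℕ (c (level a)) ℚ.* z)) (f-level a∈xs))) ⟩
  ∑ (λ a → indicator (level a ℕ.≤? n) ℚ.* (fromℕ (c (level a)) ℚ.* g a)) xs ∎
  where
  open ≡-Reasoning
  levels : List ℕ
  levels = map suc (upTo n)
  h : ℕ → ℚ
  h l = fromℕ (c l) ℚ.* f l
  size : ℕ → ℕ
  size l = length (filter (λ a → level a ℕ.≟ l) xs)
  expand : ∀ l → fromℕ (size l ℕ.* c l) ℚ.* f l ≡ ∑ (λ a → indicator (level a ℕ.≟ l) ℚ.* h l) xs
  expand l = begin
    fromℕ (size l ℕ.* c l) ℚ.* f l                          ≡⟨ cong (ℚ._* f l) (fromℕ-* (size l) (c l)) ⟩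
    fromℕ (size l) ℚ.* fromℕ (c l) ℚ.* f l                  ≡⟨ ℚₚ.*-assoc (fromℕ (size l)) (fromℕ (c l)) (f l) ⟩
    fromℕ (size l) ℚ.* h l                                  ≡⟨ cong (ℚ._* h l) (length-filter≡∑ (λ a → level a ℕ.≟ l) xs) ⟩
    ∑ (λ a → indicator (level a ℕ.≟ l)) xs ℚ.* h l          ≡⟨ ∑-*ʳ (λ a → indicator (level a ℕ.≟ l)) (h l) xs ⟨
    ∑ (λ a → indicator (level a ℕ.≟ l) ℚ.* h l) xs          ∎
  levels≤n : ∀ {l} → l ∈ levels → l ≤ n
  levels≤n l∈ with ∈-map⁻ suc l∈
  ... | _ , m∈ , refl = ∈-upTo⁻ m∈
  collapse : ∀ m → 0 < m → ∑ (λ l → indicator (m ℕ.≟ l) ℚ.* h l) levels ≡ indicator (m ℕ.≤? n) ℚ.* h m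
  collapse (suc m) _ with suc m ℕ.≤? n
  ... | yes m<n = trans
    (∑-single ℕ._≟_ h levels (Uniqueₚ.map⁺ ℕₚ.suc-injective (Uniqueₚ.upTo⁺ n)) (∈-map⁺ suc (∈-upTo⁺ m<n)))
    (sym (indicator-yes (suc m ℕ.≤? n) m<n (h (suc m))))
  ... | no m≮n = trans
    (trans (∑-cong levels λ {l} l∈ →
        indicator-no (suc m ℕ.≟ l) (λ m≡l → m≮n (subst (_≤ n) (sym m≡l) (levels≤n l∈))) (h l))
      (∑-zero levels))
    (sym (indicator-no (suc m ℕ.≤? n) m≮n (h (suc m))))

∑-tabulate : ∀ {A : Set} {n} (f : Fin n → A) (g : A → ℚ) → ∑ g (tabulate f) ≡ Table.sum (g ∘ f)
∑-tabulate {n = zero} f g = refl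
∑-tabulate {n = suc n} f g = cong (g (f Fin.zero) ℚ.+_) (∑-tabulate (f ∘ Fin.suc) g)

-- Pairs and permutations of Fin d

-- Pigeonhole: a missed value could be punched out, leaving an injection from n elements into n - 1.
injective⇒surjective : ∀ {n} (f : Fin n → Fin n) → Injective _≡_ _≡_ f → ∀ y → ∃ λ z → f z ≡ y
injective⇒surjective {suc n} f inj y with Finₚ.any? (λ z → f z Fin.≟ y)
... | yes found = found
... | no ¬found = contradiction
  (Finₚ.injective⇒≤ {f = λ z → Fin.punchOut (y≢f z)} λ eq → inj (Finₚ.punchOut-injective (y≢f _) (y≢f _) eq))
  ℕₚ.1+n≰n
  where
  y≢f : ∀ z → y ≢ f z
  y≢f z y≡fz = ¬found (z , sym y≡fz)

injective⇒permutation : ∀ {n} (f : Fin n → Fin n) → Injective _≡_ _≡_ f →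
  Σ (Permutation′ n) λ π → ∀ i → π ⟨$⟩ʳ i ≡ f i
injective⇒permutation f inj = permutation f (proj₁ ∘ sur) (proj₂ ∘ sur) (λ z → inj (proj₂ (sur (f z)))) , λ _ → refl
  where sur = injective⇒surjective f inj

∈-pairs⁻ : ∀ {d} {p : Fin d × Fin d} → p ∈ pairs d → proj₁ p Fin.< proj₂ p
∈-pairs⁻ {d} p∈ with find (∈-concatMap⁻ _ {xs = allFin d} p∈)
... | i , _ , p∈i with ∈-map⁻ _ p∈i
... | j , j∈ , refl = proj₂ (∈-filter⁻ (λ j → i Fin.<? j) {xs = allFin d} j∈)

∈-pairs⁺ : ∀ {d} {i j : Fin d} → i Fin.< j → (i , j) ∈ pairs d
∈-pairs⁺ {d} {i} {j} i<j = ∈-concatMap⁺ _ (lose (∈-allFin i)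
  (∈-map⁺ (i ,_) (∈-filter⁺ (λ j → i Fin.<? j) (∈-allFin j) i<j)))

∈-pairs⇒≢ : ∀ {d} {i j : Fin d} → (i , j) ∈ pairs d → i ≢ j
∈-pairs⇒≢ ij∈ = Finₚ.<⇒≢ (∈-pairs⁻ ij∈)

pairs-wlog : ∀ {d} {P : Fin d → Fin d → Set} → (∀ {i j} → P i j → P j i) →
  (∀ {i j} → (i , j) ∈ pairs d → P i j) → ∀ {i j} → i ≢ j → P i j
pairs-wlog P-sym P-pairs {i} {j} i≢j with Finₚ.<-cmp i j
... | tri< i<j _ _ = P-pairs (∈-pairs⁺ i<j)
... | tri≈ _ i≡j _ = contradiction i≡j i≢j
... | tri> _ _ j<i = P-sym (P-pairs (∈-pairs⁺ j<i))

module _ {d : ℕ} (g : Fin d → Fin d → ℚ) where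

  ∑-pairs : ∑ (λ p → g (proj₁ p) (proj₂ p)) (pairs d) ≡
    ∑ (λ i → ∑ (λ j → indicator (i Fin.<? j) ℚ.* g i j) (allFin d)) (allFin d)
  ∑-pairs = trans (∑-concatMap _ _ (allFin d)) (∑-cong (allFin d) λ {i} _ →
    trans (∑-map (i ,_) _ (filter (λ j → i Fin.<? j) (allFin d))) (∑-filter (λ j → i Fin.<? j) (g i) (allFin d)))

  -- The list `pairs d` is not stable under permuting vertices, but the square of all ordered pairs
  -- is. Doubling a symmetric sum with zero diagonal passes from the one to the other.
  ∑-pairs-double : (∀ i j → g i j ≡ g j i) → (∀ i → g i i ≡ 0ℚ) →
    ∑ (λ p → g (proj₁ p) (proj₂ p)) (pairs d) ℚ.+ ∑ (λ p → g (proj₁ p) (proj₂ p)) (pairs d) ≡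
    Table.sum (λ i → Table.sum (g i))
  ∑-pairs-double g-sym g-diag = begin
    ∑ g′ (pairs d) ℚ.+ ∑ g′ (pairs d)
      -- Exchanging the sums in the second copy turns its condition i < j into j < i.
      ≡⟨ cong₂ ℚ._+_ ∑-pairs (trans ∑-pairs (∑-comm _ (allFin d) (allFin d))) ⟩
    ∑ (λ i → ∑ (λ j → indicator (i Fin.<? j) ℚ.* g i j) (allFin d)) (allFin d) ℚ.+
    ∑ (λ i → ∑ (λ j → indicator (j Fin.<? i) ℚ.* g j i) (allFin d)) (allFin d)
      ≡⟨ ∑-+ _ _ (allFin d) ⟨
    ∑ (λ i → ∑ (λ j → indicator (i Fin.<? j) ℚ.* g i j) (allFin d) ℚ.+
             ∑ (λ j → indicator (j Fin.<? i) ℚ.* g j i) (allFin d)) (allFin d)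
      ≡⟨ ∑-cong (allFin d) (λ {i} _ → trans (sym (∑-+ _ _ (allFin d))) (∑-cong (allFin d) λ {j} _ → pointwise i j)) ⟩
    ∑ (λ i → ∑ (g i) (allFin d)) (allFin d)
      ≡⟨ ∑-tabulate {n = d} id _ ⟩
    Table.sum (λ i → ∑ (g i) (allFin d))
      ≡⟨ Table.sum-cong-≗ (λ i → ∑-tabulate id (g i)) ⟩
    Table.sum (λ i → Table.sum (g i)) ∎
    where
    open ≡-Reasoning
    g′ : Fin d × Fin d → ℚ
    g′ p = g (proj₁ p) (proj₂ p)
    pointwise : ∀ i j → indicator (i Fin.<? j) ℚ.* g i j ℚ.+ indicator (j Fin.<? i) ℚ.* g j i ≡ g i j
    pointwise i j with Finₚ.<-cmp i j
    ... | tri< i<j _ j≮i = trans (cong₂ ℚ._+_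
        (indicator-yes (i Fin.<? j) i<j (g i j)) (indicator-no (j Fin.<? i) j≮i (g j i)))
        (ℚₚ.+-identityʳ (g i j))
    ... | tri≈ i≮j refl _ = trans (cong₂ ℚ._+_
        (indicator-no (i Fin.<? i) i≮j (g i i)) (indicator-no (i Fin.<? i) i≮j (g i i)))
        (sym (g-diag i))
    ... | tri> i≮j _ j<i = trans (cong₂ ℚ._+_
        (indicator-no (i Fin.<? j) i≮j (g i j)) (indicator-yes (j Fin.<? i) j<i (g j i)))
        (trans (ℚₚ.+-identityˡ (g j i)) (g-sym j i))

-- After doubling, relabelling merely reindexes the rows and the columns of a full square.
∑-pairs-permute : ∀ {d} (g : Fin d → Fin d → ℚ) → (∀ i j → g i j ≡ g j i) → (∀ i → g i i ≡ 0ℚ) →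
  (π : Permutation′ d) →
  ∑ (λ p → g (π ⟨$⟩ʳ proj₁ p) (π ⟨$⟩ʳ proj₂ p)) (pairs d) ≡ ∑ (λ p → g (proj₁ p) (proj₂ p)) (pairs d)
∑-pairs-permute g g-sym g-diag π = +-double-injective (begin
  _ ≡⟨ ∑-pairs-double (λ i j → g (π ⟨$⟩ʳ i) (π ⟨$⟩ʳ j)) (λ i j → g-sym _ _) (λ i → g-diag _) ⟩
  Table.sum (λ i → Table.sum (λ j → g (π ⟨$⟩ʳ i) (π ⟨$⟩ʳ j)))
    ≡⟨ Table.sum-cong-≗ (λ i → Table.sum-permute (g (π ⟨$⟩ʳ i)) π) ⟨
  Table.sum (λ i → Table.sum (g (π ⟨$⟩ʳ i)))
    ≡⟨ Table.sum-permute (λ i → Table.sum (g i)) π ⟨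
  Table.sum (λ i → Table.sum (g i))
    ≡⟨ ∑-pairs-double g g-sym g-diag ⟨
  _ ∎)
  where open ≡-Reasoning

-- Phrased with `T?` and `<ᵇ` to match the `filterᵇ` in `numEdges`, so that edge counts become sums
-- over pairs.
positive? : ℕ → ℚ
positive? m = indicator (T? (0 ℕ.<ᵇ m))

numEdges≡∑ : ∀ {d} (u : Fin d → Fin d → ℕ) →
  fromℕ (numEdges u) ≡ ∑ (λ p → positive? (u (proj₁ p) (proj₂ p))) (pairs d)
numEdges≡∑ {d} u = length-filter≡∑ (λ p → T? (0 ℕ.<ᵇ u (proj₁ p) (proj₂ p))) (pairs d)

positive?-1 : ∀ {m} → 0 < m → positive? m ≡ 1ℚ
positive?-1 {suc m} _ = refl

positive?-mono : ∀ {l m} → (0 < l → 0 < m) → positive? l ℚ.≤ positive? m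
positive?-mono {zero} {zero} _ = ℚₚ.≤-refl
positive?-mono {zero} {suc m} _ = fromℕ-mono-≤ {0} {1} z≤n
positive?-mono {suc l} {zero} 0<⇒ with () ← 0<⇒ (s≤s z≤n)
positive?-mono {suc l} {suc m} _ = ℚₚ.≤-refl

positive?-reflects : ∀ {l m} → positive? l ≡ positive? m → 0 < m → 0 < l
positive?-reflects {zero} {suc m} ()
positive?-reflects {suc l} _ _ = s≤s z≤n

-- Valuations

infix 4 _<∞_

_<∞_ : ℚ → ℚ∞ → Set
_ <∞ nothing = ⊤
o <∞ just q = o ℚ.< q

<∞-≤∞-trans : ∀ {o} a b → o <∞ a → a ≤∞ b → o <∞ b
<∞-≤∞-trans _ nothing _ _ = tt
<∞-≤∞-trans (just a) (just b) o<a a≤b = ℚₚ.<-≤-trans o<a a≤b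

<∞-min∞ : ∀ {o} a b → o <∞ a → o <∞ b → o <∞ min∞ a b
<∞-min∞ nothing b _ o<b = o<b
<∞-min∞ (just a) nothing o<a _ = o<a
<∞-min∞ (just a) (just b) o<a o<b with ℚₚ.⊓-sel a b
... | inj₁ eq = subst (_ ℚ.<_) (sym eq) o<a
... | inj₂ eq = subst (_ ℚ.<_) (sym eq) o<b

p+p≡0⇒p≡0 : ∀ {p} → p ℚ.+ p ≡ 0ℚ → p ≡ 0ℚ
p+p≡0⇒p≡0 eq = +-double-injective (trans eq (sym (ℚₚ.+-identityʳ 0ℚ)))

module Valuation (S : Setting) where
  open Setting S
  open Field Kbar hiding (Carrier)

  𝕃 : CommutativeRing _ _
  𝕃 = record { isCommutativeRing = isCommutativeRing }

  open CommutativeRing 𝕃 using (ring; +-identityˡ; +-identityʳ; +-assoc; +-comm; *-identityˡ; -‿inverseʳ; -‿inverseˡ)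
  open Algebra.Properties.Ring ring public using (-‿involutive; -1*x≈-x; -‿+-comm; x∙y⁻¹≈ε⇒x≈y)

  ord-finite : ∀ {y} → y ≢ 0# → ∃ λ q → ord y ≡ just q
  ord-finite {y} y≢0 with ord y in eq
  ... | nothing = contradiction (ord-∞ y eq) y≢0
  ... | just q = q , refl

  finite⇒≢0 : ∀ {y q} → ord y ≡ just q → y ≢ 0#
  finite⇒≢0 eq refl with () ← trans (sym ord-0) eq

  ord-1 : ord 1# ≡ just 0ℚ
  ord-1 with ord-finite {1#} (0≢1 ∘ sym)
  ... | q , eq = trans eq (cong just (sym (identity q q+q≡q)))
    where
    q+q≡q : q ℚ.+ q ≡ q
    q+q≡q = just-injective (trans (sym (cong₂ _+∞_ eq eq)) (trans (sym (ord-* 1# 1#)) (trans (cong ord (*-identityˡ 1#)) eq)))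
    identity : ∀ q → q ℚ.+ q ≡ q → 0ℚ ≡ q
    identity q eq = sym (trans (solve 1 (λ a → a := (a :+ a) :+ :- a) refl q) (trans (cong (ℚ._+ ℚ.- q) eq) (ℚₚ.+-inverseʳ q)))

  -1*-1≡1 : (- 1#) * (- 1#) ≡ 1#
  -1*-1≡1 = trans (-1*x≈-x (- 1#)) (-‿involutive 1#)

  -- The square of -1 is 1, so twice its valuation is 0.
  ord-‿1 : ord (- 1#) ≡ just 0ℚ
  ord-‿1 = halve (ord (- 1#)) (trans (sym (ord-* (- 1#) (- 1#))) (trans (cong ord -1*-1≡1) ord-1))
    where
    halve : ∀ a → a +∞ a ≡ just 0ℚ → a ≡ just 0ℚ
    halve (just q) eq = cong just (p+p≡0⇒p≡0 (just-injective eq))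

  0+∞ : ∀ a → just 0ℚ +∞ a ≡ a
  0+∞ nothing = refl
  0+∞ (just a) = cong just (ℚₚ.+-identityˡ a)

  ord-neg : ∀ y → ord (- y) ≡ ord y
  ord-neg y = trans (cong ord (sym (-1*x≈-x y))) (trans (ord-* (- 1#) y) (trans (cong (_+∞ ord y) ord-‿1) (0+∞ (ord y))))

  ord-sub-comm : ∀ y z → ord (y - z) ≡ ord (z - y)
  ord-sub-comm y z = trans (sym (ord-neg (y - z))) (cong ord
    (trans (sym (-‿+-comm y (- z))) (trans (cong (- y +_) (-‿involutive z)) (+-comm (- y) z))))

  sub-telescope : ∀ y z t → (y - z) + (z - t) ≡ y - t
  sub-telescope y z t = trans (+-assoc y (- z) (z - t)) (cong (y +_)
    (trans (sym (+-assoc (- z) z (- t))) (trans (cong (_+ (- t)) (-‿inverseˡ z)) (+-identityˡ (- t)))))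

  ord-⁻¹ : ∀ {y q} → ord y ≡ just q → ord (y ⁻¹) ≡ just (ℚ.- q)
  ord-⁻¹ {y} {q} eq = inv (ord (y ⁻¹)) (trans (cong (_+∞ ord (y ⁻¹)) (sym eq))
    (trans (sym (ord-* y (y ⁻¹))) (trans (cong ord (inverseʳ y (finite⇒≢0 eq))) ord-1)))
    where
    inv : ∀ a → just q +∞ a ≡ just 0ℚ → a ≡ just (ℚ.- q)
    inv (just a) h = cong just (trans (solve 2 (λ a q → a := :- q :+ (q :+ a)) refl a q)
      (trans (cong (ℚ.- q ℚ.+_) (just-injective h)) (ℚₚ.+-identityʳ _)))

  ord-^ : ∀ {y q} m → ord y ≡ just q → ord (y ^ m) ≡ just (fromℕ m ℚ.* q)
  ord-^ {q = q} zero _ = trans ord-1 (cong just (sym (ℚₚ.*-zeroˡ q)))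
  ord-^ {y} {q} (suc m) eq = trans (ord-* y (y ^ m)) (trans (cong₂ _+∞_ eq (ord-^ m eq))
    (cong just (sym (fromℕ-suc-* m q))))

  ord-prod : ∀ {A : Set} (g : A → Carrier Kbar) (h : A → ℚ) xs →
    (∀ {a} → a ∈ xs → ord (g a) ≡ just (h a)) → ord (prod (map g xs)) ≡ just (∑ h xs)
  ord-prod g h [] _ = ord-1
  ord-prod g h (a ∷ xs) eq = trans (ord-* _ _) (cong₂ _+∞_ (eq (here refl)) (ord-prod g h xs (eq ∘ there)))

  <∞-ord-+ : ∀ {o} y z → o <∞ ord y → o <∞ ord z → o <∞ ord (y + z)
  <∞-ord-+ y z o<y o<z = <∞-≤∞-trans _ _ (<∞-min∞ (ord y) (ord z) o<y o<z) (ord-+ y z)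

  <∞-ord-sum : ∀ {A : Set} {o} (g : A → Carrier Kbar) xs → (∀ {a} → a ∈ xs → o <∞ ord (g a)) →
    o <∞ ord (sumF (map g xs))
  <∞-ord-sum g [] _ = subst (_ <∞_) (sym ord-0) tt
  <∞-ord-sum g (a ∷ xs) lt = <∞-ord-+ _ _ (lt (here refl)) (<∞-ord-sum g xs (lt ∘ there))

  -- If y + z had valuation above o, so would y = (y + z) - z. Conversely, every bound below o is
  -- exceeded by both summands, hence by the sum.
  ord-+-dominant : ∀ {o} y z → ord y ≡ just o → o <∞ ord z → ord (y + z) ≡ just o
  ord-+-dominant {o} y z eq o<z = squeeze (ord (y + z)) not-above not-below
    where
    cancel : (y + z) + (- z) ≡ y
    cancel = trans (+-assoc y z (- z)) (trans (cong (y +_) (-‿inverseʳ z)) (+-identityʳ y))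
    not-above : ¬ (o <∞ ord (y + z))
    not-above o<y+z = ℚₚ.<-irrefl refl (subst (o <∞_) (trans (cong ord cancel) eq)
      (<∞-ord-+ (y + z) (- z) o<y+z (subst (o <∞_) (sym (ord-neg z)) o<z)))
    not-below : ∀ {o′} → o′ ℚ.< o → o′ <∞ ord (y + z)
    not-below o′<o = <∞-ord-+ y z (subst (_ <∞_) (sym eq) o′<o) (weaken (ord z) o<z)
      where
      weaken : ∀ a → o <∞ a → _ <∞ a
      weaken nothing _ = tt
      weaken (just _) o<a = ℚₚ.<-trans o′<o o<a
    squeeze : ∀ a → ¬ (o <∞ a) → (∀ {o′} → o′ ℚ.< o → o′ <∞ a) → a ≡ just o
    squeeze nothing ¬above _ = contradiction tt ¬above
    squeeze (just a) ¬above ¬below = cong just (ℚₚ.≤-antisym (ℚₚ.≮⇒≥ ¬above)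
      (ℚₚ.≮⇒≥ λ a<o → ℚₚ.<-irrefl refl (¬below a<o)))

  -- Uniqueness of the list excludes a second copy of the dominant term, which could otherwise
  -- cancel against the first.
  ord-sum-dominant : ∀ {A : Set} {o} (g : A → Carrier Kbar) {a} xs → Unique xs → a ∈ xs →
    ord (g a) ≡ just o → (∀ {b} → b ∈ xs → b ≢ a → o <∞ ord (g b)) →
    ord (sumF (map g xs)) ≡ just o
  ord-sum-dominant g (a ∷ xs) (a∉xs ∷ᵘ _) (here refl) eq lt = ord-+-dominant _ _ eq
    (<∞-ord-sum g xs λ b∈xs → lt (there b∈xs) (All.lookup a∉xs b∈xs ∘ sym))
  ord-sum-dominant g (b ∷ xs) (b∉xs ∷ᵘ u) (there a∈xs) eq lt = trans (cong ord (+-comm _ _))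
    (ord-+-dominant _ _ (ord-sum-dominant g xs u a∈xs eq (lt ∘ there)) (lt (here refl) (All.lookup b∉xs a∈xs)))

  -- Were all terms of valuation above o, the ultrametric inequality would put the sum above o as
  -- well.
  ord-sum⇒term : ∀ {A : Set} {o} (g : A → Carrier Kbar) (h : A → ℚ) xs →
    (∀ a → ord (g a) ≡ just (h a)) → ord (sumF (map g xs)) ≡ just o → ∃ λ a → a ∈ xs × h a ℚ.≤ o
  ord-sum⇒term {o = o} g h xs ord-g eq with Any.any? (λ a → h a ℚₚ.≤? o) xs
  ... | yes found = let a , a∈xs , ha≤o = find found in a , a∈xs , ha≤o
  ... | no ¬found = contradiction (subst (o <∞_) eq (<∞-ord-sum g xs λ {a} a∈xs →
    subst (o <∞_) (sym (ord-g a)) (ℚₚ.≰⇒> λ ha≤o → ¬found (lose a∈xs ha≤o)))) (ℚₚ.<-irrefl refl)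

-- Orbits

entry : ∀ {d} → Vec (Vec ℕ d) d → Fin d → Fin d → ℕ
entry M i j = Vec.lookup (Vec.lookup M i) j

matrix : ∀ {d} → (Fin d → Fin d → ℕ) → Vec (Vec ℕ d) d
matrix u = Vec.tabulate λ i → Vec.tabulate (u i)

entry-matrix : ∀ {d} (u : Fin d → Fin d → ℕ) i j → entry (matrix u) i j ≡ u i j
entry-matrix u i j = trans (cong (λ row → Vec.lookup row j) (Vecₚ.lookup∘tabulate _ i)) (Vecₚ.lookup∘tabulate (u i) j)

matrix-entry : ∀ {d} (M : Vec (Vec ℕ d) d) → matrix (entry M) ≡ M
matrix-entry M = trans (Vecₚ.tabulate-cong λ i → Vecₚ.tabulate∘lookup (Vec.lookup M i)) (Vecₚ.tabulate∘lookup M)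

matrix-cong : ∀ {d} {u u′ : Fin d → Fin d → ℕ} → (∀ i j → u i j ≡ u′ i j) → matrix u ≡ matrix u′
matrix-cong eq = Vecₚ.tabulate-cong λ i → Vecₚ.tabulate-cong (eq i)

allᵇ⁻ : ∀ {A : Set} {p : A → Bool} {a} xs → allᵇ p xs ≡ true → a ∈ xs → p a ≡ true
allᵇ⁻ {p = p} (b ∷ xs) all a∈ with p b in eq
allᵇ⁻ (b ∷ xs) all (here refl) | true = eq
allᵇ⁻ (b ∷ xs) all (there a∈xs) | true = allᵇ⁻ xs all a∈xs

allᵇ⁺ : ∀ {A : Set} {p : A → Bool} xs → (∀ a → p a ≡ true) → allᵇ p xs ≡ true
allᵇ⁺ [] _ = refl
allᵇ⁺ (b ∷ xs) all = cong₂ _∧_ (all b) (allᵇ⁺ xs all)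

injᵇ-sound : ∀ {d} (π : Vec (Fin d) d) → injᵇ π ≡ true → Injective _≡_ _≡_ (Vec.lookup π)
injᵇ-sound {d} π inj {a} {b} eq with a Fin.≟ b | Vec.lookup π a Fin.≟ Vec.lookup π b
  | allᵇ⁻ (allFin d) (allᵇ⁻ (allFin d) inj (∈-allFin a)) (∈-allFin b)
... | yes a≡b | _ | _ = a≡b
... | no _ | no πa≢πb | _ = contradiction eq πa≢πb

injᵇ-complete : ∀ {d} (π : Vec (Fin d) d) → Injective _≡_ _≡_ (Vec.lookup π) → injᵇ π ≡ true
injᵇ-complete {d} π inj = allᵇ⁺ (allFin d) λ a → allᵇ⁺ (allFin d) (check a)
  where
  check : ∀ a b → does (a Fin.≟ b) ∨ not (does (Vec.lookup π a Fin.≟ Vec.lookup π b)) ≡ true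
  check a b with a Fin.≟ b | Vec.lookup π a Fin.≟ Vec.lookup π b
  ... | yes _ | _ = refl
  ... | no _ | no _ = refl
  ... | no a≢b | yes eq = contradiction (inj eq) a≢b

∈-allVecs : ∀ {d m} (π : Vec (Fin d) m) → π ∈ allVecs d m
∈-allVecs Vec.[] = here refl
∈-allVecs (i Vec.∷ π) = ∈-concatMap⁺ _ (lose (∈-allFin i) (∈-map⁺ (i Vec.∷_) (∈-allVecs π)))

orbit-unique : ∀ {d} (u : Fin d → Fin d → ℕ) → Unique (orbit u)
orbit-unique u = DecUnique.deduplicate-! (Vecₚ.≡-dec (Vecₚ.≡-dec ℕ._≟_)) _

-- The orbit stores only matrices; the relabelling behind one is recovered from the injectivity test
-- on vectors.
∈-orbit⁻ : ∀ {d} (u : Fin d → Fin d → ℕ) {M} → M ∈ orbit u →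
  Σ (Permutation′ d) λ π → ∀ i j → entry M i j ≡ u (π ⟨$⟩ʳ i) (π ⟨$⟩ʳ j)
∈-orbit⁻ {d} u M∈ with ∈-map⁻ _ (∈-deduplicate⁻ (Vecₚ.≡-dec (Vecₚ.≡-dec ℕ._≟_)) _ M∈)
... | π , π∈ , refl with ∈-filter⁻ (T? ∘ injᵇ) {xs = allVecs d d} π∈
... | _ , inj with injective⇒permutation (Vec.lookup π) (injᵇ-sound π (Equivalence.to T-≡ inj))
... | ρ , ρ≡π = ρ , λ i j → trans (entry-matrix (λ a b → u (Vec.lookup π a) (Vec.lookup π b)) i j)
  (sym (cong₂ u (ρ≡π i) (ρ≡π j)))

matrix∈orbit : ∀ {d} (u : Fin d → Fin d → ℕ) → matrix u ∈ orbit u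
matrix∈orbit {d} u = ∈-deduplicate⁺ (Vecₚ.≡-dec (Vecₚ.≡-dec ℕ._≟_))
  (subst (_∈ map relabel (perms d)) (matrix-cong λ i j → cong₂ u (Vecₚ.lookup∘tabulate id i) (Vecₚ.lookup∘tabulate id j))
    (∈-map⁺ relabel (∈-filter⁺ (T? ∘ injᵇ) (∈-allVecs identity) (Equivalence.from T-≡ (injᵇ-complete identity inj)))))
  where
  relabel : Vec (Fin d) d → Vec (Vec ℕ d) d
  relabel π = matrix λ a b → u (Vec.lookup π a) (Vec.lookup π b)
  identity : Vec (Fin d) d
  identity = Vec.tabulate id
  inj : Injective _≡_ _≡_ (Vec.lookup identity)
  inj {a} {b} eq = trans (sym (Vecₚ.lookup∘tabulate id a)) (trans eq (Vecₚ.lookup∘tabulate id b))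

-- Ranks

module _ {A : Set} {P Q : A → Set} (P? : ∀ a → Dec (P a)) (Q? : ∀ a → Dec (Q a)) (P⊆Q : ∀ {a} → P a → Q a) where

  length-filter-mono-≤ : ∀ xs → length (filter P? xs) ≤ length (filter Q? xs)
  length-filter-mono-≤ [] = z≤n
  length-filter-mono-≤ (a ∷ xs) with P? a | Q? a
  ... | yes _ | yes _ = s≤s (length-filter-mono-≤ xs)
  ... | yes p | no ¬q = contradiction (P⊆Q p) ¬q
  ... | no _ | yes _ = ℕₚ.m≤n⇒m≤1+n (length-filter-mono-≤ xs)
  ... | no _ | no _ = length-filter-mono-≤ xs

  length-filter-mono-< : ∀ {a} xs → a ∈ xs → ¬ P a → Q a → length (filter P? xs) < length (filter Q? xs)
  length-filter-mono-< (b ∷ xs) (here refl) ¬p q with P? b | Q? b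
  ... | yes p | _ = contradiction p ¬p
  ... | no _ | yes _ = s≤s (length-filter-mono-≤ xs)
  ... | no _ | no ¬q = contradiction q ¬q
  length-filter-mono-< (b ∷ xs) (there a∈xs) ¬p q with P? b | Q? b
  ... | yes _ | yes _ = s≤s (length-filter-mono-< xs a∈xs ¬p q)
  ... | yes p | no ¬q = contradiction (P⊆Q p) ¬q
  ... | no _ | yes _ = ℕₚ.m≤n⇒m≤1+n (length-filter-mono-< xs a∈xs ¬p q)
  ... | no _ | no _ = length-filter-mono-< xs a∈xs ¬p q

lookup-injective : ∀ {A : Set} {xs : List A} → Unique xs → Injective _≡_ _≡_ (lookup xs)
lookup-injective {xs = _ ∷ _} _ {Fin.zero} {Fin.zero} _ = refl
lookup-injective {xs = _ ∷ xs} (a∉xs ∷ᵘ _) {Fin.zero} {Fin.suc j} eq = contradiction eq (All.lookup a∉xs (∈-lookup {xs = xs} j))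
lookup-injective {xs = _ ∷ xs} (a∉xs ∷ᵘ _) {Fin.suc i} {Fin.zero} eq = contradiction (sym eq) (All.lookup a∉xs (∈-lookup {xs = xs} i))
lookup-injective {xs = _ ∷ _} (_ ∷ᵘ u) {Fin.suc i} {Fin.suc j} eq = cong Fin.suc (lookup-injective u eq)

module Rank (S : Setting) {d : ℕ} (x : Fin d → Carrier (Setting.Kbar S)) where
  open Roots S x

  D-unique : Unique D
  D-unique = DecUnique.deduplicate-! ℚₚ._≟_ _

  v∈D : ∀ {i j} → (i , j) ∈ pairs d → v i j ∈ D
  v∈D ij∈ = ∈-deduplicate⁺ ℚₚ._≟_ (∈-map⁺ _ ij∈)

  D⇒v : ∀ {r} → r ∈ D → ∃ λ i → ∃ λ j → (i , j) ∈ pairs d × r ≡ v i j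
  D⇒v r∈D with ∈-map⁻ _ (∈-deduplicate⁻ ℚₚ._≟_ _ r∈D)
  ... | (i , j) , ij∈ , eq = i , j , ij∈ , eq

  rank-antitone : ∀ {q r} → q ℚ.≤ r → rank r ≤ rank q
  rank-antitone {q} {r} q≤r = s≤s (length-filter-mono-≤ (r ℚₚ.<?_) (q ℚₚ.<?_) (ℚₚ.≤-<-trans q≤r) D)

  -- The value r itself is counted in `rank q` but not in `rank r`.
  rank-antitone-< : ∀ {q r} → r ∈ D → q ℚ.< r → rank r < rank q
  rank-antitone-< {q} {r} r∈D q<r = s≤s (length-filter-mono-< (r ℚₚ.<?_) (q ℚₚ.<?_) (ℚₚ.<-trans q<r) D
    r∈D (ℚₚ.<-irrefl refl) q<r)

  rank-cancel-≤ : ∀ {q r} → r ∈ D → rank q ≤ rank r → r ℚ.≤ q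
  rank-cancel-≤ r∈D le = ℚₚ.≮⇒≥ λ q<r → ℕₚ.<⇒≱ (rank-antitone-< r∈D q<r) le

  rank-cancel-< : ∀ {q r} → rank q < rank r → r ℚ.< q
  rank-cancel-< lt = ℚₚ.≰⇒> λ q≤r → ℕₚ.<⇒≱ lt (rank-antitone q≤r)

  rank-injective : ∀ {q r} → q ∈ D → r ∈ D → rank q ≡ rank r → q ≡ r
  rank-injective q∈D r∈D eq = ℚₚ.≤-antisym
    (rank-cancel-≤ q∈D (ℕₚ.≤-reflexive (sym eq))) (rank-cancel-≤ r∈D (ℕₚ.≤-reflexive eq))

  rank≤k : ∀ {r} → r ∈ D → rank r ≤ k
  rank≤k {r} r∈D = filter-notAll (r ℚₚ.<?_) D (lose r∈D (ℚₚ.<-irrefl refl))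

  -- The k distinct values in `D` have k distinct ranks among 1, ..., k, so every rank occurs. The
  -- auxiliary `index` is the rank counted from 0.
  rank-surjective : ∀ {m} → m < k → ∃ λ r → r ∈ D × rank r ≡ suc m
  rank-surjective {m} m<k with injective⇒surjective index index-injective (Fin.fromℕ< m<k)
    where
    bound : ∀ i → length (filter (lookup D i ℚₚ.<?_) D) < k
    bound i = rank≤k (∈-lookup i)
    index : Fin k → Fin k
    index i = Fin.fromℕ< (bound i)
    index-injective : Injective _≡_ _≡_ index
    index-injective {i} {j} eq = lookup-injective D-unique (rank-injective (∈-lookup i) (∈-lookup j)
      (cong suc (Finₚ.fromℕ<-injective _ _ (bound i) (bound j) eq)))
  ... | i , eq = lookup D i , ∈-lookup i ,
    cong suc (trans (sym (Finₚ.toℕ-fromℕ< _)) (trans (cong Fin.toℕ eq) (Finₚ.toℕ-fromℕ< m<k)))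

  -- The filtered list contains r, so the default 0 of `dd` does not arise, and its head has the
  -- rank of r, hence equals r.
  dd-rank : ∀ {r} → r ∈ D → dd (rank r) ≡ r
  dd-rank {r} r∈D with filter (λ s → rank s ℕ.≟ rank r) D
    in eq
  ... | s ∷ _ with ∈-filter⁻ (λ s → rank s ℕ.≟ rank r) {xs = D} (subst (s ∈_) (sym eq) (here refl))
  ... | s∈D , same = rank-injective s∈D r∈D same
  dd-rank {r} r∈D | [] with () ← subst (r ∈_) eq (∈-filter⁺ (λ s → rank s ℕ.≟ rank r) r∈D refl)

-- The optimal weight of a single edge.

module Thresholds (n : ℕ) (D : List ℚ) (rank : ℚ → ℕ) (threshold : ℕ → ℚ)
  (0<rank : ∀ q → 0 < rank q)
  (rank-cancel-≤ : ∀ {q r} → r ∈ D → rank q ≤ rank r → r ℚ.≤ q)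
  (rank-cancel-< : ∀ {q r} → rank q < rank r → r ℚ.< q)
  (rank-injective : ∀ {q r} → q ∈ D → r ∈ D → rank q ≡ rank r → q ≡ r)
  (rank-threshold : ∀ {t} → t ≤ n → threshold t ∈ D × rank (threshold t) ≡ suc n ∸ t)
  where

  -- The weight that G_{n+1}(f) gives to an edge of valuation q.
  W : ℚ → ℕ
  W q = suc (suc n) ∸ rank q

  dₙ₊₁ : ℚ
  dₙ₊₁ = threshold 0

  -- Total of the thresholds d_{n+1}, d_n, …: raising the weight of an edge from t to t + 1 pays off
  -- exactly when its valuation is at least d_{n+1-t}.
  cost : ℕ → ℚ
  cost zero = 0ℚ
  cost (suc t) = cost t ℚ.+ threshold t

  profit : ℕ → ℚ → ℚ
  profit m q = fromℕ m ℚ.* q ℚ.+ ℚ.- cost m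

  -- The gain from one more unit of weight is q minus a threshold. Thresholds grow with the weight,
  -- so profit is concave in m and peaks where the gain changes sign.
  profit-suc : ∀ m q → profit (suc m) q ≡ profit m q ℚ.+ (q ℚ.+ ℚ.- threshold m)
  profit-suc m q = trans (cong (ℚ._+ ℚ.- cost (suc m)) (fromℕ-suc-* m q))
    (solve 4 (λ q a c e → (q :+ a) :+ :- (c :+ e) := (a :+ :- c) :+ (q :+ :- e)) refl
      q (fromℕ m ℚ.* q) (cost m) (threshold m))

  dₙ₊₁∈D : dₙ₊₁ ∈ D
  dₙ₊₁∈D = proj₁ (rank-threshold z≤n)

  rank-dₙ₊₁ : rank dₙ₊₁ ≡ suc n
  rank-dₙ₊₁ = proj₂ (rank-threshold z≤n)

  threshold≤ : ∀ {t r} → r ∈ D → t ℕ.+ rank r ≤ suc n → threshold t ℚ.≤ r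
  threshold≤ {t} {r} r∈D le = rank-cancel-≤ (proj₁ thr∈) (ℕₚ.≤-trans
    (ℕₚ.m+n≤o⇒m≤o∸n (rank r) (subst (_≤ suc n) (ℕₚ.+-comm t (rank r)) le))
    (ℕₚ.≤-reflexive (sym (proj₂ thr∈))))
    where
    thr∈ = rank-threshold {t} (ℕₚ.≤-pred (ℕₚ.≤-trans (ℕₚ.m<m+n t (0<rank r)) le))

  <threshold : ∀ {t q} → t ≤ n → suc n < t ℕ.+ rank q → q ℚ.< threshold t
  <threshold {t} {q} t≤n lt = rank-cancel-< (subst (_< rank q) (sym (proj₂ (rank-threshold t≤n)))
    (ℕₚ.+-cancelˡ-< t _ _ (subst (_< t ℕ.+ rank q) (sym (ℕₚ.m+[n∸m]≡n (ℕₚ.m≤n⇒m≤1+n t≤n))) lt)))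

  -- As long as the weight plus the rank of r is at most n + 1, the next threshold is at most r and
  -- a further unit of weight loses nothing.
  profit-ascent : ∀ j m {r} → r ∈ D → j ℕ.+ m ℕ.+ rank r ≤ suc (suc n) → profit m r ℚ.≤ profit (j ℕ.+ m) r
  profit-ascent zero m r∈D _ = ℚₚ.≤-refl
  profit-ascent (suc j) m {r} r∈D (s≤s le) = ℚₚ.≤-trans (profit-ascent j m r∈D (ℕₚ.m≤n⇒m≤1+n le)) (begin
    profit (j ℕ.+ m) r                                             ≡⟨ ℚₚ.+-identityʳ _ ⟨
    profit (j ℕ.+ m) r ℚ.+ 0ℚ                                      ≡⟨ cong (profit (j ℕ.+ m) r ℚ.+_) (ℚₚ.+-inverseʳ δ) ⟨
    profit (j ℕ.+ m) r ℚ.+ (δ ℚ.+ ℚ.- δ)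
      ≤⟨ ℚₚ.+-monoʳ-≤ (profit (j ℕ.+ m) r) (ℚₚ.+-monoˡ-≤ (ℚ.- δ) (threshold≤ {j ℕ.+ m} r∈D le)) ⟩
    profit (j ℕ.+ m) r ℚ.+ (r ℚ.+ ℚ.- δ)                           ≡⟨ profit-suc (j ℕ.+ m) r ⟨
    profit (suc (j ℕ.+ m)) r                                       ∎)
    where
    open ℚₚ.≤-Reasoning
    δ = threshold (j ℕ.+ m)

  profit-step-< : ∀ {m q} → m ≤ n → suc n < m ℕ.+ rank q → profit (suc m) q ℚ.< profit m q
  profit-step-< {m} {q} m≤n lt = begin-strict
    profit (suc m) q                    ≡⟨ profit-suc m q ⟩
    profit m q ℚ.+ (q ℚ.+ ℚ.- δ)        <⟨ ℚₚ.+-monoʳ-< (profit m q) (ℚₚ.+-monoˡ-< (ℚ.- δ) (<threshold m≤n lt)) ⟩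
    profit m q ℚ.+ (δ ℚ.+ ℚ.- δ)        ≡⟨ cong (profit m q ℚ.+_) (ℚₚ.+-inverseʳ δ) ⟩
    profit m q ℚ.+ 0ℚ                   ≡⟨ ℚₚ.+-identityʳ _ ⟩
    profit m q                          ∎
    where
    open ℚₚ.≤-Reasoning
    δ = threshold m

  -- Once the weight plus the rank exceeds n + 1, every further unit loses strictly. Steps start
  -- from weights up to n, the range in which thresholds are genuine values of `D`.
  profit-descent : ∀ j m {q} → suc n < m ℕ.+ rank q → j ℕ.+ m ≤ n → profit (suc (j ℕ.+ m)) q ℚ.< profit m q
  profit-descent zero m lt le = profit-step-< le lt
  profit-descent (suc j) m {q} lt le = ℚₚ.<-trans
    (profit-step-< le (ℕₚ.≤-trans lt (ℕₚ.+-monoˡ-≤ (rank q) (ℕₚ.m≤n+m m (suc j)))))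
    (profit-descent j m lt (ℕₚ.<⇒≤ le))

  profit-above : ∀ {m q} → m ≤ suc n → W q < m → profit m q ℚ.< profit (W q) q
  profit-above {suc m} {q} (s≤s m≤n) (s≤s W≤m) = subst (λ z → profit (suc z) q ℚ.< profit (W q) q) (ℕₚ.m∸n+n≡m W≤m)
    (profit-descent (m ∸ W q) (W q)
      -- Truncated subtraction can only enlarge `W q`, so `W q + rank q` is at least n + 2 for every
      -- rank.
      (ℕₚ.≤-trans (ℕₚ.m≤n+m∸n (suc (suc n)) (rank q)) (ℕₚ.≤-reflexive (ℕₚ.+-comm (rank q) (W q))))
      (subst (_≤ n) (sym (ℕₚ.m∸n+n≡m W≤m)) m≤n))

  profit-below : ∀ {m r} → r ∈ D → m ≤ W r → profit m r ℚ.≤ profit (W r) r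
  profit-below {m} {r} r∈D m≤W with rank r ℕ.≤? suc (suc n)
  ... | yes r≤ = subst (λ z → profit m r ℚ.≤ profit z r) (ℕₚ.m∸n+n≡m m≤W)
    (profit-ascent (W r ∸ m) m r∈D (ℕₚ.≤-reflexive
      (trans (cong (ℕ._+ rank r) (ℕₚ.m∸n+n≡m m≤W)) (ℕₚ.m∸n+n≡m r≤))))
  ... | no r≰ = ℚₚ.≤-reflexive (cong (λ z → profit z r) (trans (ℕₚ.n≤0⇒n≡0 (subst (m ≤_) W≡0 m≤W)) (sym W≡0)))
    where
    W≡0 : W r ≡ 0
    W≡0 = ℕₚ.m≤n⇒m∸n≡0 (ℕₚ.<⇒≤ (ℕₚ.≰⇒> r≰))

  profit-max : ∀ {m r} → r ∈ D → m ≤ suc n → profit m r ℚ.≤ profit (W r) r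
  profit-max {m} {r} r∈D m≤ with m ℕ.≤? W r
  ... | yes m≤W = profit-below r∈D m≤W
  ... | no m≰W = ℚₚ.<⇒≤ (profit-above m≤ (ℕₚ.≰⇒> m≰W))

  -- Only an upper bound on m: at a valuation equal to `threshold t` the weights t and t + 1 earn
  -- the same profit. Maximisers need not be unique, and `W q` is the largest.
  profit-max-tight : ∀ {m q} → m ≤ suc n → profit m q ≡ profit (W q) q → m ≤ W q
  profit-max-tight m≤ eq = ℕₚ.≮⇒≥ λ W<m → ℚₚ.<⇒≢ (profit-above m≤ W<m) eq

  W≤ : ∀ q → W q ≤ suc n
  W≤ q = ℕₚ.∸-monoʳ-≤ (suc (suc n)) (0<rank q)

  W-beyond : ∀ {r} → r ∈ D → n < rank r → (r ≡ dₙ₊₁ × W r ≡ 1) ⊎ W r ≡ 0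
  W-beyond {r} r∈D n<r with ℕₚ.m≤n⇒m<n∨m≡n n<r
  ... | inj₁ n+1<r = inj₂ (ℕₚ.m≤n⇒m∸n≡0 n+1<r)
  ... | inj₂ n+1≡r = inj₁ (rank-injective r∈D dₙ₊₁∈D (trans (sym n+1≡r) (sym rank-dₙ₊₁)) ,
    trans (cong (suc (suc n) ∸_) (sym n+1≡r)) (ℕₚ.m+n∸n≡m 1 (suc n)))

  -- Outside E_n either the optimal weight is 0, or it is 1 at valuation `dₙ₊₁`, where the gain
  -- equals the cost of the first unit.
  profit-beyond : ∀ {r} → r ∈ D → n < rank r → profit (W r) r ≡ 0ℚ
  profit-beyond {r} r∈D n<r with W-beyond r∈D n<r
  ... | inj₁ (r≡d , W≡1) = trans (cong₂ profit W≡1 r≡d)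
    (solve 1 (λ d → con 1ℚ :* d :+ :- (con 0ℚ :+ d) := con 0ℚ) refl dₙ₊₁)
  ... | inj₂ W≡0 = trans (cong (λ z → profit z r) W≡0)
    (solve 1 (λ d → con 0ℚ :* d :+ :- con 0ℚ := con 0ℚ) refl r)

  cost-0∨1 : ∀ {m} → (m ≡ 0) ⊎ (m ≡ 1) → cost m ≡ positive? m ℚ.* dₙ₊₁
  cost-0∨1 (inj₁ refl) = sym (ℚₚ.*-zeroˡ dₙ₊₁)
  cost-0∨1 (inj₂ refl) = trans (ℚₚ.+-identityˡ dₙ₊₁) (sym (ℚₚ.*-identityˡ dₙ₊₁))

  W-mono : ∀ {q r} → rank r ≤ rank q → W q ≤ W r
  W-mono = ℕₚ.∸-monoʳ-≤ (suc (suc n))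

  W-threshold : ∀ {t} → t ≤ n → W (threshold t) ≡ suc t
  W-threshold {t} t≤n = trans (cong (suc (suc n) ∸_) (proj₂ (rank-threshold t≤n)))
    (trans (ℕₚ.+-∸-assoc 1 (ℕₚ.m∸n≤m (suc n) t)) (cong suc (ℕₚ.m∸[m∸n]≡n (ℕₚ.m≤n⇒m≤1+n t≤n))))

  W-beyond-0∨1 : ∀ {r} → r ∈ D → n < rank r → (W r ≡ 0) ⊎ (W r ≡ 1)
  W-beyond-0∨1 r∈D n<r with W-beyond r∈D n<r
  ... | inj₁ (_ , W≡1) = inj₂ W≡1
  ... | inj₂ W≡0 = inj₁ W≡0

  W-positive : ∀ {q} → rank q ≤ n → 0 < W q
  W-positive r≤n = ℕₚ.m<n⇒0<n∸m (s≤s (ℕₚ.m≤n⇒m≤1+n r≤n))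

  -- Here h and g are the weights of one edge in H and in G_n(f). On E_n the costs cancel and leave
  -- weight times valuation; outside, the profit is 0 and each edge of H costs `dₙ₊₁`.
  profit-cost : ∀ {q h g} → q ∈ D →
    (rank q ≤ n → h ≡ W q × 0 < g) → (n < rank q → ((h ≡ 0) ⊎ (h ≡ 1)) × g ≡ 0) →
    profit (W q) q ℚ.+ cost h ≡
    indicator (rank q ℕ.≤? n) ℚ.* (fromℕ (W q) ℚ.* q) ℚ.+ (positive? h ℚ.+ ℚ.- positive? g) ℚ.* dₙ₊₁
  profit-cost {q} {h} {g} q∈D inside outside with ℕₚ.≤-<-connex (rank q) n
  ... | inj₁ r≤n = begin
    profit (W q) q ℚ.+ cost h
      ≡⟨ cong (λ m → profit (W q) q ℚ.+ cost m) (proj₁ (inside r≤n)) ⟩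
    profit (W q) q ℚ.+ cost (W q)
      ≡⟨ solve 3 (λ a c t → (a :+ :- c) :+ c := a :+ (con 1ℚ :+ :- con 1ℚ) :* t) refl (fromℕ (W q) ℚ.* q) (cost (W q)) dₙ₊₁ ⟩
    fromℕ (W q) ℚ.* q ℚ.+ (1ℚ ℚ.+ ℚ.- 1ℚ) ℚ.* dₙ₊₁
      ≡⟨ cong₂ (λ a b → fromℕ (W q) ℚ.* q ℚ.+ (a ℚ.+ ℚ.- b) ℚ.* dₙ₊₁)
           (positive?-1 (subst (0 <_) (sym (proj₁ (inside r≤n))) (W-positive r≤n))) (positive?-1 (proj₂ (inside r≤n))) ⟨
    fromℕ (W q) ℚ.* q ℚ.+ (positive? h ℚ.+ ℚ.- positive? g) ℚ.* dₙ₊₁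
      ≡⟨ cong (ℚ._+ _) (indicator-yes (rank q ℕ.≤? n) r≤n _) ⟨
    _ ∎
    where open ≡-Reasoning
  ... | inj₂ n<r = begin
    profit (W q) q ℚ.+ cost h
      ≡⟨ cong₂ ℚ._+_ (profit-beyond q∈D n<r) (cost-0∨1 (proj₁ (outside n<r))) ⟩
    0ℚ ℚ.+ positive? h ℚ.* dₙ₊₁
      ≡⟨ cong (λ a → 0ℚ ℚ.+ a ℚ.* dₙ₊₁) (ℚₚ.+-identityʳ (positive? h)) ⟨
    0ℚ ℚ.+ (positive? h ℚ.+ ℚ.- positive? 0) ℚ.* dₙ₊₁
      ≡⟨ cong₂ (λ a m → a ℚ.+ (positive? h ℚ.+ ℚ.- positive? m) ℚ.* dₙ₊₁)
           (indicator-no (rank q ℕ.≤? n) (ℕₚ.<⇒≱ n<r) _) (proj₂ (outside n<r)) ⟨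
    _ ∎
    where open ≡-Reasoning

  -- Weights h of a graph in 𝒢_{n+1}(f) agree with W on E_n and are 0 or 1 outside, so comparing
  -- numbers of edges amounts to comparing total weights.
  weight-balance : ∀ {q h} → q ∈ D → (rank q ≤ n → h ≡ W q) → (n < rank q → (h ≡ 0) ⊎ (h ≡ 1)) →
    fromℕ h ℚ.+ positive? (W q) ≡ positive? h ℚ.+ fromℕ (W q)
  weight-balance {q} {h} q∈D inside outside with ℕₚ.≤-<-connex (rank q) n
  ... | inj₁ r≤n = trans (cong (λ m → fromℕ m ℚ.+ positive? (W q)) (inside r≤n)) (trans
    (ℚₚ.+-comm (fromℕ (W q)) (positive? (W q))) (cong (λ m → positive? m ℚ.+ fromℕ (W q)) (sym (inside r≤n))))
  ... | inj₂ n<r = 0∨1-balance (outside n<r) (W-beyond-0∨1 q∈D n<r)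
    where
    fromℕ≡positive? : ∀ {m} → (m ≡ 0) ⊎ (m ≡ 1) → fromℕ m ≡ positive? m
    fromℕ≡positive? (inj₁ refl) = refl
    fromℕ≡positive? (inj₂ refl) = refl
    0∨1-balance : ∀ {l m} → (l ≡ 0) ⊎ (l ≡ 1) → (m ≡ 0) ⊎ (m ≡ 1) → fromℕ l ℚ.+ positive? m ≡ positive? l ℚ.+ fromℕ m
    0∨1-balance l01 m01 = cong₂ ℚ._+_ (fromℕ≡positive? l01) (sym (fromℕ≡positive? m01))

-- The formula for A and the weights of G_n(f).

module Weights (S : Setting) {d : ℕ} (x : Fin d → Carrier (Setting.Kbar S)) where
  open Roots S x
  open Rank S x

  divℕ-spec : ∀ q {m} → 0 < m → fromℕ m ℚ.* divℕ q m ≡ q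
  divℕ-spec q {suc m} _ = trans (solve 3 (λ m q r → m :* (q :* r) := q :* (m :* r)) refl
      (fromℕ (suc m)) q ((ℤ.+ 1) ℚ./ suc m))
    (trans (cong (q ℚ.*_) (fromℕ-suc*1/ m)) (ℚₚ.*-identityʳ q))

  -- The sum Σ e_l (n+2-l) d_l over l ≤ n inside A.
  baseTerms : ℕ → ℚ
  baseTerms n = ∑ (λ l → fromℕ (e l ℕ.* (suc (suc n) ∸ l)) ℚ.* dd l) (map suc (upTo n))

  -- Opaque, since A-cases would otherwise normalise the formula when it abstracts over ord (J H).
  opaque
    A-value : ℕ → WGraph d → ℚ → ℚ
    A-value n H o = divℕ (ℚ.- o ℚ.- fromℕ 2 ℚ.* baseTerms n) (2 ℕ.* (numEdges (w H) ∸ numEdges (wG n)))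

    A-value≡ : ∀ n H o → A-value n H o ≡ divℕ (ℚ.- o ℚ.- fromℕ 2 ℚ.* baseTerms n) (2 ℕ.* (numEdges (w H) ∸ numEdges (wG n)))
    A-value≡ n H o = refl

  A-cases : ∀ n H → (Setting.ord S (J H) ≡ nothing × A n H ≡ nothing) ⊎
    (∃ λ o → Setting.ord S (J H) ≡ just o × A n H ≡ just (A-value n H o))
  A-cases n H with Setting.ord S (J H)
  ... | nothing = inj₁ (refl , refl)
  ... | just o = inj₂ (o , refl , cong just (sym (A-value≡ n H o)))

  A-just : ∀ n H {o} → Setting.ord S (J H) ≡ just o → A n H ≡ just (A-value n H o)
  A-just n H = resolve (A-cases n H)
    where
    resolve : ∀ {a b o} {g : ℚ → ℚ} → (a ≡ nothing × b ≡ nothing) ⊎ (∃ λ o → a ≡ just o × b ≡ just (g o)) →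
      a ≡ just o → b ≡ just (g o)
    resolve (inj₁ (refl , _)) ()
    resolve (inj₂ (_ , refl , b≡)) refl = b≡

  wG-diag : ∀ m i → wG m i i ≡ 0
  wG-diag m i with i Fin.≟ i | rank (v i i) ℕ.≤? m
  ... | yes _ | _ = refl
  ... | no i≢i | _ = contradiction refl i≢i

  -- Truncated subtraction is already 0 for ranks above m, so one formula covers both branches.
  wG-off : ∀ m {i j} → i ≢ j → wG m i j ≡ suc m ∸ rank (v i j)
  wG-off m {i} {j} i≢j with i Fin.≟ j | rank (v i j) ℕ.≤? m
  ... | yes i≡j | _ = contradiction i≡j i≢j
  ... | no _ | yes _ = refl
  ... | no _ | no r≰m = sym (ℕₚ.m≤n⇒m∸n≡0 (ℕₚ.≰⇒> r≰m))

  wG'-in : ∀ m {i j} → i ≢ j → rank (v i j) ≤ m → wG' m i j ≡ suc (suc m) ∸ rank (v i j)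
  wG'-in m {i} {j} i≢j r≤m with i Fin.≟ j | rank (v i j) ℕ.≤? m
  ... | yes i≡j | _ = contradiction i≡j i≢j
  ... | no _ | yes _ = refl
  ... | no _ | no r≰m = contradiction r≤m r≰m

  -- Minus half the valuation of the term of J attached to u.
  value : (Fin d → Fin d → ℕ) → ℚ
  value u = ∑ (λ p → fromℕ (u (proj₁ p) (proj₂ p)) ℚ.* v (proj₁ p) (proj₂ p)) (pairs d)

  module Level (n : ℕ) (n<k : n < k) where

    -- For t at most n the index n + 1 - t lies between 1 and k, so it is the rank of some value.
    rank-dd : ∀ {t} → t ≤ n → dd (suc n ∸ t) ∈ D × rank (dd (suc n ∸ t)) ≡ suc n ∸ t
    rank-dd {t} t≤n = from-witness (rank-surjective (ℕₚ.≤-<-trans (ℕₚ.m∸n≤m n t) n<k))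
      where
      at : ∀ {r l} → r ∈ D → rank r ≡ l → dd l ∈ D × rank (dd l) ≡ l
      at r∈D refl = subst (λ z → z ∈ D × rank z ≡ rank _) (sym (dd-rank r∈D)) (r∈D , refl)
      from-witness : (∃ λ r → r ∈ D × rank r ≡ suc (n ∸ t)) → dd (suc n ∸ t) ∈ D × rank (dd (suc n ∸ t)) ≡ suc n ∸ t
      from-witness (r , r∈D , eq) = at r∈D (trans eq (sym (ℕₚ.+-∸-assoc 1 t≤n)))

    open Thresholds n D rank (λ t → dd (suc n ∸ t)) (λ _ → s≤s z≤n)
      rank-cancel-≤ rank-cancel-< rank-injective rank-dd public

    top : Fin d → Fin d → ℕ
    top = wG (suc n)

    top-off : ∀ {i j} → i ≢ j → top i j ≡ W (v i j)
    top-off = wG-off (suc n)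

    baseTerms≡∑ : baseTerms n ≡ ∑ (λ p → indicator (rank (v (proj₁ p) (proj₂ p)) ℕ.≤? n) ℚ.*
      (fromℕ (W (v (proj₁ p) (proj₂ p))) ℚ.* v (proj₁ p) (proj₂ p))) (pairs d)
    baseTerms≡∑ = ∑-by-level (λ p → rank (v (proj₁ p) (proj₂ p))) (λ p → v (proj₁ p) (proj₂ p))
      (suc (suc n) ∸_) dd n (pairs d) (λ _ → s≤s z≤n) (dd-rank ∘ v∈D)

-- Valuations of differences of distinct roots.

module Distinct (S : Setting) {d : ℕ} (x : Fin d → Carrier (Setting.Kbar S))
  (x-injective : ∀ i j → x i ≡ x j → i ≡ j) where
  open Setting S using (Kbar; ord; ord-+)
  open Field Kbar using (_-_)
  open Roots S x
  open Rank S x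
  open Valuation S
  open Weights S x

  -- Distinct roots have a nonzero difference, so the default value of `toℚ` is not met.
  ord-v : ∀ {i j} → i ≢ j → ord (x i - x j) ≡ just (v i j)
  ord-v {i} {j} i≢j = just-toℚ (ord-finite λ eq → i≢j (x-injective i j (x∙y⁻¹≈ε⇒x≈y (x i) (x j) eq)))
    where
    just-toℚ : ∀ {a} → (∃ λ q → a ≡ just q) → a ≡ just (toℚ a)
    just-toℚ (_ , refl) = refl

  v-sym : ∀ i j → v i j ≡ v j i
  v-sym i j = cong toℚ (ord-sub-comm (x i) (x j))

  v-ultrametric : ∀ {i j l} → i ≢ j → j ≢ l → i ≢ l → v j l ℚ.⊓ v i l ℚ.≤ v i j
  v-ultrametric {i} {j} {l} i≢j j≢l i≢l = subst (ℚ._≤ v i j) (trans (ℚₚ.⊓-comm (v i l) (v l j)) (cong (ℚ._⊓ v i l) (v-sym l j)))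
    (≤∞⇒≤ (ord-v i≢l) (ord-v (j≢l ∘ sym)) (trans (cong ord telescope) (ord-v i≢j)) (ord-+ (x i - x l) (x l - x j)))
    where
    telescope : Field._+_ Kbar (x i - x l) (x l - x j) ≡ x i - x j
    telescope = sub-telescope (x i) (x l) (x j)
    ≤∞⇒≤ : ∀ {a b c p q r} → a ≡ just p → b ≡ just q → c ≡ just r → min∞ a b ≤∞ c → p ℚ.⊓ q ℚ.≤ r
    ≤∞⇒≤ refl refl refl le = le

  value-double : ∀ u → ∑ (λ p → fromℕ (2 ℕ.* uncurry u p) ℚ.* uncurry v p) (pairs d) ≡ value u ℚ.+ value u
  value-double u = trans (∑-cong (pairs d) λ {p} _ → double (uncurry u p) (uncurry v p)) (∑-+ _ _ (pairs d))
    where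
    double : ∀ m q → fromℕ (2 ℕ.* m) ℚ.* q ≡ fromℕ m ℚ.* q ℚ.+ fromℕ m ℚ.* q
    double m q = trans (cong (ℚ._* q) (trans (fromℕ-* 2 m) (trans (fromℕ-suc-* 1 (fromℕ m)) (cong (fromℕ m ℚ.+_) (ℚₚ.*-identityˡ (fromℕ m))))))
      (ℚₚ.*-distribʳ-+ q (fromℕ m) (fromℕ m))

  ord-term : ∀ M → ord (term M) ≡ just (ℚ.- (value (entry M) ℚ.+ value (entry M)))
  ord-term M = trans (ord-⁻¹ (ord-prod _ (λ p → fromℕ (2 ℕ.* uncurry (entry M) p) ℚ.* uncurry v p) (pairs d)
      λ {p} p∈ → ord-^ (2 ℕ.* uncurry (entry M) p) (ord-v (∈-pairs⇒≢ p∈))))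
    (cong (just ∘ ℚ.-_) (value-double (entry M)))

  wG-sym : ∀ m i j → wG m i j ≡ wG m j i
  wG-sym m i j = by-cases (i Fin.≟ j)
    where
    by-cases : Dec (i ≡ j) → wG m i j ≡ wG m j i
    by-cases (yes refl) = refl
    by-cases (no i≢j) = trans (wG-off m i≢j) (trans (cong (λ q → suc m ∸ rank q) (v-sym i j))
      (sym (wG-off m (i≢j ∘ sym))))

  v∈D-off : ∀ {i j} → i ≢ j → v i j ∈ D
  v∈D-off = pairs-wlog {P = λ i j → v i j ∈ D} (λ {i} {j} → subst (_∈ D) (v-sym i j)) v∈D

  -- The rearrangement inequality for relabellings.

  module Rearrangement (n : ℕ) (n<k : n < k) where
    open Level n n<k

    module Candidate (H : WGraph d) (H∈ : InCalG n H) where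

      H-in : ∀ {i j} → i ≢ j → rank (v i j) ≤ n → w H i j ≡ W (v i j)
      H-in {i} {j} i≢j r≤n = trans (proj₁ (proj₂ H∈) i j (i≢j , r≤n)) (wG'-in n i≢j r≤n)

      H-out : ∀ {i j} → i ≢ j → n < rank (v i j) → (w H i j ≡ 0) ⊎ (w H i j ≡ 1)
      H-out {i} {j} i≢j n<r = proj₁ (proj₂ (proj₂ H∈)) i j i≢j λ ij∈E → ℕₚ.<⇒≱ n<r (proj₂ ij∈E)

      H≤ : ∀ i j → w H i j ≤ suc n
      H≤ i j = by-cases (i Fin.≟ j) (ℕₚ.≤-<-connex (rank (v i j)) n)
        where
        0∨1≤ : ∀ {m} → (m ≡ 0) ⊎ (m ≡ 1) → m ≤ suc n
        0∨1≤ (inj₁ refl) = z≤n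
        0∨1≤ (inj₂ refl) = s≤s z≤n
        by-cases : Dec (i ≡ j) → (rank (v i j) ≤ n) ⊎ (n < rank (v i j)) → w H i j ≤ suc n
        by-cases (yes refl) _ = subst (_≤ suc n) (sym (w-diag H i)) z≤n
        by-cases (no i≢j) (inj₁ r≤n) = subst (_≤ suc n) (sym (H-in i≢j r≤n)) (W≤ (v i j))
        by-cases (no i≢j) (inj₂ n<r) = 0∨1≤ (H-out i≢j n<r)

      wG-positive : ∀ {i j} → i ≢ j → rank (v i j) ≤ n → 0 < wG n i j
      wG-positive i≢j r≤n = subst (0 <_) (sym (wG-off n i≢j)) (ℕₚ.m<n⇒0<n∸m (s≤s r≤n))

      wG-zero : ∀ {i j} → i ≢ j → n < rank (v i j) → wG n i j ≡ 0
      wG-zero i≢j n<r = trans (wG-off n i≢j) (ℕₚ.m≤n⇒m∸n≡0 n<r)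

      wG-positive⁻ : ∀ {i j} → i ≢ j → 0 < wG n i j → rank (v i j) ≤ n
      wG-positive⁻ i≢j 0<wG = ℕₚ.≮⇒≥ λ n<r → ℕₚ.<⇒≢ 0<wG (sym (wG-zero i≢j n<r))

      H-positive : ∀ {i j} → i ≢ j → rank (v i j) ≤ n → 0 < w H i j
      H-positive i≢j r≤n = subst (0 <_) (sym (H-in i≢j r≤n)) (W-positive r≤n)

      edge-mono : ∀ {p} → p ∈ pairs d → positive? (uncurry (wG n) p) ℚ.≤ positive? (uncurry (w H) p)
      edge-mono p∈ = positive?-mono (H-positive (∈-pairs⇒≢ p∈) ∘ wG-positive⁻ (∈-pairs⇒≢ p∈))

      -- H contains E_n, so equal counts would force equal edge sets, against the new edge of H.
      -- This makes the denominator of A positive.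
      numEdges-< : numEdges (wG n) < numEdges (w H)
      numEdges-< = ℕₚ.≰⇒> λ le →
        let i , j , i≢j , ij∉E , w≡1 = proj₁ (proj₂ (proj₂ (proj₂ H∈)))
        in ij∉E (i≢j , wG-positive⁻ i≢j (no-new-edge le i≢j (subst (0 <_) (sym w≡1) (s≤s z≤n))))
        where
        no-new-edge : numEdges (w H) ≤ numEdges (wG n) → ∀ {i j} → i ≢ j → 0 < w H i j → 0 < wG n i j
        no-new-edge le = pairs-wlog {P = λ i j → 0 < w H i j → 0 < wG n i j}
          (λ {i} {j} P → subst (0 <_) (wG-sym n i j) ∘ P ∘ subst (0 <_) (w-sym H j i))
          λ ij∈ → positive?-reflects (∑-≤-tight (pairs d) edge-mono
            (subst₂ ℚ._≤_ (numEdges≡∑ (w H)) (numEdges≡∑ (wG n)) (fromℕ-mono-≤ le)) ij∈)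

      excess : ℕ
      excess = numEdges (w H) ∸ numEdges (wG n)

      0<excess : 0 < excess
      0<excess = ℕₚ.m<n⇒0<n∸m numEdges-<

      excess≡∑ : fromℕ excess ≡ ∑ (λ p → positive? (uncurry (w H) p) ℚ.+ ℚ.- positive? (uncurry (wG n) p)) (pairs d)
      excess≡∑ = trans (fromℕ-∸ (ℕₚ.<⇒≤ numEdges-<)) (trans
        (cong₂ (λ a b → a ℚ.+ ℚ.- b) (numEdges≡∑ (w H)) (numEdges≡∑ (wG n)))
        (sym (trans (∑-+ _ _ (pairs d)) (cong (∑ _ (pairs d) ℚ.+_) (∑-neg _ (pairs d))))))

      -- Every edge earns its best profit, and the costs of H are added back. The latter total is
      -- common to all relabellings of H.
      bound : ℚ
      bound = ∑ (λ p → profit (W (uncurry v p)) (uncurry v p)) (pairs d) ℚ.+ ∑ (cost ∘ uncurry (w H)) (pairs d)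

      bound≡ : bound ≡ baseTerms n ℚ.+ fromℕ excess ℚ.* dₙ₊₁
      bound≡ = begin
        bound ≡⟨ ∑-+ _ _ (pairs d) ⟨
        ∑ (λ p → profit (W (uncurry v p)) (uncurry v p) ℚ.+ cost (uncurry (w H) p)) (pairs d)
          ≡⟨ ∑-cong (pairs d) (λ p∈ → let i≢j = ∈-pairs⇒≢ p∈ in profit-cost (v∈D p∈)
               (λ r≤n → H-in i≢j r≤n , wG-positive i≢j r≤n) (λ n<r → H-out i≢j n<r , wG-zero i≢j n<r)) ⟩
        ∑ (λ p → indicator (rank (uncurry v p) ℕ.≤? n) ℚ.* (fromℕ (W (uncurry v p)) ℚ.* uncurry v p) ℚ.+
          (positive? (uncurry (w H) p) ℚ.+ ℚ.- positive? (uncurry (wG n) p)) ℚ.* dₙ₊₁) (pairs d)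
          ≡⟨ ∑-+ _ _ (pairs d) ⟩
        _ ≡⟨ cong₂ ℚ._+_ (sym baseTerms≡∑) (trans (∑-*ʳ _ dₙ₊₁ (pairs d)) (cong (ℚ._* dₙ₊₁) (sym excess≡∑))) ⟩
        baseTerms n ℚ.+ fromℕ excess ℚ.* dₙ₊₁ ∎
        where open ≡-Reasoning

      module Relabelling (M : Fin d → Fin d → ℕ) (π : Permutation′ d)
        (M≡ : ∀ i j → M i j ≡ w H (π ⟨$⟩ʳ i) (π ⟨$⟩ʳ j)) where

        M≤ : ∀ i j → M i j ≤ suc n
        M≤ i j = subst (_≤ suc n) (sym (M≡ i j)) (H≤ _ _)

        -- The condition on g at 0 makes the summand vanish on the diagonal, as the passage to all
        -- ordered pairs requires.
        ∑-relabel : ∀ (g : ℕ → ℚ) → g 0 ≡ 0ℚ → ∑ (g ∘ uncurry M) (pairs d) ≡ ∑ (g ∘ uncurry (w H)) (pairs d)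
        ∑-relabel g g0≡0 = trans (∑-cong (pairs d) λ {p} _ → cong g (M≡ (proj₁ p) (proj₂ p)))
          (∑-pairs-permute (λ i j → g (w H i j)) (λ i j → cong g (w-sym H i j))
            (λ i → trans (cong g (w-diag H i)) g0≡0) π)

        value-split : value M ≡ ∑ (λ p → profit (uncurry M p) (uncurry v p)) (pairs d) ℚ.+ ∑ (cost ∘ uncurry (w H)) (pairs d)
        value-split = trans (∑-cong (pairs d) λ {p} _ → split (fromℕ (uncurry M p) ℚ.* uncurry v p) (cost (uncurry M p)))
          (trans (∑-+ _ _ (pairs d)) (cong (∑ _ (pairs d) ℚ.+_) (∑-relabel cost refl)))
          where
          split : ∀ a c → a ≡ (a ℚ.+ ℚ.- c) ℚ.+ c
          split = solve 2 (λ a c → a := (a :+ :- c) :+ c) refl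

        profit≤ : ∀ {p} → p ∈ pairs d → profit (uncurry M p) (uncurry v p) ℚ.≤ profit (W (uncurry v p)) (uncurry v p)
        profit≤ {p} p∈ = profit-max (v∈D p∈) (M≤ (proj₁ p) (proj₂ p))

        value≤bound : value M ℚ.≤ bound
        value≤bound = subst (ℚ._≤ bound) (sym value-split)
          (ℚₚ.+-monoˡ-≤ (∑ (cost ∘ uncurry (w H)) (pairs d)) (∑-mono-≤ (pairs d) profit≤))

        -- Attaining the bound leaves no slack at any edge, so each weight is a maximiser of profit
        -- and hence at most the largest one.
        bound≤value⇒≤W : bound ℚ.≤ value M → ∀ {p} → p ∈ pairs d → uncurry M p ≤ W (uncurry v p)
        bound≤value⇒≤W le {p} p∈ = profit-max-tight (M≤ (proj₁ p) (proj₂ p)) (∑-≤-tight (pairs d) profit≤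
          (+-cancelʳ-≤ (∑ (cost ∘ uncurry (w H)) (pairs d)) (subst (bound ℚ.≤_) value-split le)) p∈)

        M-sym : ∀ i j → M i j ≡ M j i
        M-sym i j = trans (M≡ i j) (trans (w-sym H _ _) (sym (M≡ j i)))

        M-diag : ∀ i → M i i ≡ 0
        M-diag i = trans (M≡ i i) (w-diag H _)

        top-balance : ∀ {p} → p ∈ pairs d →
          fromℕ (uncurry (w H) p) ℚ.+ positive? (uncurry top p) ≡ positive? (uncurry (w H) p) ℚ.+ fromℕ (uncurry top p)
        top-balance {p} p∈ = subst (λ m → fromℕ (uncurry (w H) p) ℚ.+ positive? m ≡ positive? (uncurry (w H) p) ℚ.+ fromℕ m)
          (sym (top-off (∈-pairs⇒≢ p∈))) (weight-balance (v∈D p∈) (H-in (∈-pairs⇒≢ p∈)) (H-out (∈-pairs⇒≢ p∈)))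

        -- By `top-balance`, the total weights of H and `top` differ exactly as their edge counts
        -- do, and M has the same total weight as H.
        ∑top≤∑M : numEdges top ≤ numEdges (w H) → ∑ (fromℕ ∘ uncurry top) (pairs d) ℚ.≤ ∑ (fromℕ ∘ uncurry M) (pairs d)
        ∑top≤∑M le = subst (∑ (fromℕ ∘ uncurry top) (pairs d) ℚ.≤_) (sym (∑-relabel fromℕ refl))
          (+-cancelˡ-≤ (∑ (positive? ∘ uncurry (w H)) (pairs d)) (begin
            ∑ (positive? ∘ uncurry (w H)) (pairs d) ℚ.+ ∑ (fromℕ ∘ uncurry top) (pairs d)
              ≡⟨ ∑-+ _ _ (pairs d) ⟨
            ∑ (λ p → positive? (uncurry (w H) p) ℚ.+ fromℕ (uncurry top p)) (pairs d)
              ≡⟨ ∑-cong (pairs d) top-balance ⟨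
            ∑ (λ p → fromℕ (uncurry (w H) p) ℚ.+ positive? (uncurry top p)) (pairs d)
              ≡⟨ ∑-+ _ _ (pairs d) ⟩
            ∑ (fromℕ ∘ uncurry (w H)) (pairs d) ℚ.+ ∑ (positive? ∘ uncurry top) (pairs d)
              ≤⟨ ℚₚ.+-monoʳ-≤ (∑ (fromℕ ∘ uncurry (w H)) (pairs d))
                   (subst₂ ℚ._≤_ (numEdges≡∑ top) (numEdges≡∑ (w H)) (fromℕ-mono-≤ le)) ⟩
            ∑ (fromℕ ∘ uncurry (w H)) (pairs d) ℚ.+ ∑ (positive? ∘ uncurry (w H)) (pairs d)
              ≡⟨ ℚₚ.+-comm (∑ (fromℕ ∘ uncurry (w H)) (pairs d)) (∑ (positive? ∘ uncurry (w H)) (pairs d)) ⟩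
            ∑ (positive? ∘ uncurry (w H)) (pairs d) ℚ.+ ∑ (fromℕ ∘ uncurry (w H)) (pairs d) ∎))
          where open ℚₚ.≤-Reasoning

        -- Attaining the bound gives M at most `top` at each edge, while the edge count gives M at
        -- least the total weight of `top`; both together leave only equality.
        maximal⇒top : bound ℚ.≤ value M → numEdges top ≤ numEdges (w H) → ∀ i j → M i j ≡ top i j
        maximal⇒top le edges i j = by-cases (i Fin.≟ j)
          where
          M≤top : ∀ {p} → p ∈ pairs d → fromℕ (uncurry M p) ℚ.≤ fromℕ (uncurry top p)
          M≤top {p} p∈ = fromℕ-mono-≤ (subst (uncurry M p ≤_) (sym (top-off (∈-pairs⇒≢ p∈))) (bound≤value⇒≤W le p∈))
          by-cases : Dec (i ≡ j) → M i j ≡ top i j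
          by-cases (yes refl) = trans (M-diag i) (sym (wG-diag (suc n) i))
          by-cases (no i≢j) = pairs-wlog {P = λ i j → M i j ≡ top i j}
            (λ {i} {j} eq → trans (M-sym j i) (trans eq (wG-sym (suc n) i j)))
            (λ ij∈ → fromℕ-injective (∑-≤-tight (pairs d) M≤top (∑top≤∑M edges) ij∈)) i≢j

        value≡bound : (∀ i j → M i j ≡ top i j) → value M ≡ bound
        value≡bound M≡top = trans value-split (cong (ℚ._+ ∑ (cost ∘ uncurry (w H)) (pairs d))
          (∑-cong (pairs d) λ {p} p∈ → cong (λ m → profit m (uncurry v p)) (trans (M≡top (proj₁ p) (proj₂ p)) (top-off (∈-pairs⇒≢ p∈)))))

      -- The quantity q for which ord J = -2 (total q) is A_{n+1}(H, f), and total d_{n+1} is the bound.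
      total : ℚ → ℚ
      total q = baseTerms n ℚ.+ fromℕ excess ℚ.* q

      total-cancel-≤ : ∀ {p q} → total p ℚ.≤ total q → p ℚ.≤ q
      total-cancel-≤ le = ℚₚ.*-cancelˡ-≤-pos (fromℕ excess) {{fromℕ-positive 0<excess}} (+-cancelˡ-≤ (baseTerms n) le)

      -- This is the definition of A with its denominator `2 * excess` cleared, which is legitimate
      -- since `excess` is positive.
      total-A-value : ∀ o → ℚ.- o ≡ total (A-value n H o) ℚ.+ total (A-value n H o)
      total-A-value o = solve-o (trans (cong (fromℕ (2 ℕ.* excess) ℚ.*_) (A-value≡ n H o))
        (divℕ-spec (ℚ.- o ℚ.- fromℕ 2 ℚ.* baseTerms n) (ℕₚ.m≤n⇒m≤n+o _ 0<excess)))
        where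
        solve-o : ∀ {a} → fromℕ (2 ℕ.* excess) ℚ.* a ≡ ℚ.- o ℚ.- fromℕ 2 ℚ.* baseTerms n → ℚ.- o ≡ total a ℚ.+ total a
        solve-o {a} h = begin
          ℚ.- o
            ≡⟨ solve 3 (λ o t b → :- o := (:- o :+ :- (t :* b)) :+ t :* b) refl o (fromℕ 2) (baseTerms n) ⟩
          (ℚ.- o ℚ.- fromℕ 2 ℚ.* baseTerms n) ℚ.+ fromℕ 2 ℚ.* baseTerms n
            ≡⟨ cong (ℚ._+ fromℕ 2 ℚ.* baseTerms n) h ⟨
          fromℕ (2 ℕ.* excess) ℚ.* a ℚ.+ fromℕ 2 ℚ.* baseTerms n
            ≡⟨ cong (λ c → c ℚ.* a ℚ.+ fromℕ 2 ℚ.* baseTerms n) (fromℕ-* 2 excess) ⟩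
          fromℕ 2 ℚ.* fromℕ excess ℚ.* a ℚ.+ fromℕ 2 ℚ.* baseTerms n
            ≡⟨ solve 3 (λ c a b → (con (fromℕ 2) :* c) :* a :+ con (fromℕ 2) :* b := (b :+ c :* a) :+ (b :+ c :* a)) refl (fromℕ excess) a (baseTerms n) ⟩
          total a ℚ.+ total a ∎
          where open ≡-Reasoning

      -- Some term of J has valuation at most o. That valuation is minus twice the value of a
      -- relabelling.
      dominant-relabelling : ∀ {o} → ord (J H) ≡ just o → ∃ λ M → Σ (Permutation′ d) λ π →
        (∀ i j → M i j ≡ w H (π ⟨$⟩ʳ i) (π ⟨$⟩ʳ j)) × ℚ.- o ℚ.≤ value M ℚ.+ value M
      dominant-relabelling {o} eq =
        let M , M∈ , le = ord-sum⇒term term _ (orbit (w H)) ord-term eq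
            π , M≡ = ∈-orbit⁻ (w H) M∈
        in entry M , π , M≡ ,
          subst (ℚ.- o ℚ.≤_) (neg-involutive (value (entry M) ℚ.+ value (entry M))) (ℚₚ.neg-antimono-≤ le)

      A≤dₙ₊₁ : ∀ {o} → ord (J H) ≡ just o → A-value n H o ℚ.≤ dₙ₊₁
      A≤dₙ₊₁ {o} eq = let M , π , M≡ , le = dominant-relabelling eq in
        total-cancel-≤ (subst (total (A-value n H o) ℚ.≤_) bound≡ (ℚₚ.≤-trans
          (+-double-cancel-≤ (subst (ℚ._≤ value M ℚ.+ value M) (total-A-value o) le))
          (Relabelling.value≤bound M π M≡)))

    -- The graph G_{n+1}(f) as a member of the candidate set.

    topGraph : WGraph d
    topGraph = record { w = top ; w-sym = wG-sym (suc n) ; w-diag = wG-diag (suc n) }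

    top-ultrametric : ∀ i j l → i ≢ j → j ≢ l → i ≢ l → top j l ℕ.⊓ top i l ≤ top i j
    top-ultrametric i j l i≢j j≢l i≢l = subst₂ _≤_ (sym (cong₂ ℕ._⊓_ (top-off j≢l) (top-off i≢l))) (sym (top-off i≢j))
      (by-cases (ℚₚ.⊓-sel (v j l) (v i l)))
      where
      v≤ : v j l ℚ.⊓ v i l ℚ.≤ v i j
      v≤ = v-ultrametric i≢j j≢l i≢l
      by-cases : (v j l ℚ.⊓ v i l ≡ v j l) ⊎ (v j l ℚ.⊓ v i l ≡ v i l) → W (v j l) ℕ.⊓ W (v i l) ≤ W (v i j)
      by-cases (inj₁ eq) = ℕₚ.≤-trans (ℕₚ.m⊓n≤m _ _) (W-mono (rank-antitone (subst (ℚ._≤ v i j) eq v≤)))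
      by-cases (inj₂ eq) = ℕₚ.≤-trans (ℕₚ.m⊓n≤n _ _) (W-mono (rank-antitone (subst (ℚ._≤ v i j) eq v≤)))

    -- A pair of valuation d_{n+1-t} receives the weight n + 2 - (n + 1 - t) = t + 1.
    top-attains : ∀ {t} → t ≤ n → ∃ λ i → ∃ λ j → i ≢ j × rank (v i j) ≡ suc n ∸ t × top i j ≡ suc t
    top-attains t≤n = let i , j , ij∈ , eq = D⇒v (proj₁ (rank-dd t≤n)) in
      i , j , ∈-pairs⇒≢ ij∈ , trans (cong rank (sym eq)) (proj₂ (rank-dd t≤n)) ,
      trans (top-off (∈-pairs⇒≢ ij∈)) (trans (cong W (sym eq)) (W-threshold t≤n))

    topGraph∈ : InCalG n topGraph
    topGraph∈ = ((suc n , s≤s z≤n , top≤ , surjective) , top-ultrametric) , inside , outside , new-edge , transitive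
      where
      top≤ : ∀ i j → top i j ≤ suc n
      top≤ i j = by-cases (i Fin.≟ j)
        where
        by-cases : Dec (i ≡ j) → top i j ≤ suc n
        by-cases (yes refl) = subst (_≤ suc n) (sym (wG-diag (suc n) i)) z≤n
        by-cases (no i≢j) = subst (_≤ suc n) (sym (top-off i≢j)) (W≤ (v i j))
      surjective : ∀ m → 1 ≤ m → m ≤ suc n → ∃ λ i → ∃ λ j → top i j ≡ m
      surjective (suc t) _ (s≤s t≤n) = let i , j , _ , _ , eq = top-attains t≤n in i , j , eq
      inside : ∀ i j → inE n i j → top i j ≡ wG' n i j
      inside i j (i≢j , r≤n) = trans (top-off i≢j) (sym (wG'-in n i≢j r≤n))
      outside : ∀ i j → i ≢ j → ¬ inE n i j → (top i j ≡ 0) ⊎ (top i j ≡ 1)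
      outside i j i≢j ij∉E = subst (λ m → (m ≡ 0) ⊎ (m ≡ 1)) (sym (top-off i≢j))
        (W-beyond-0∨1 (v∈D-off i≢j) (ℕₚ.≰⇒> λ r≤n → ij∉E (i≢j , r≤n)))
      -- The case t = 0 supplies a pair of rank n + 1, just outside E_n.
      new-edge : ∃ λ i → ∃ λ j → i ≢ j × ¬ inE n i j × (top i j ≡ 1)
      new-edge = let i , j , i≢j , r≡ , eq = top-attains z≤n in
        i , j , i≢j , (λ ij∈E → ℕₚ.1+n≰n (subst (_≤ n) r≡ (proj₂ ij∈E))) , eq
      transitive : ∀ i j l → i ≢ j → j ≢ l → i ≢ l → 0 < top i j → 0 < top j l → 0 < top i l
      -- The ultrametric inequality bounds the third weight below by the minimum of two positive
      -- weights.
      transitive i j l i≢j j≢l i≢l 0<ij 0<jl = ℕₚ.<-≤-trans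
        (ℕₚ.⊓-glb (subst (0 <_) (wG-sym (suc n) j l) 0<jl) 0<ij)
        (top-ultrametric i l j i≢l (j≢l ∘ sym) i≢j)

    A-topGraph : A n topGraph ≡ just dₙ₊₁
    A-topGraph = trans (A-just n topGraph ord-J) (cong just A-value-top)
      where
      open Candidate topGraph topGraph∈
      value-top : value top ≡ bound
      value-top = Relabelling.value≡bound top Perm.id (λ _ _ → refl) (λ _ _ → refl)
      value-matrix : value (entry (matrix top)) ≡ bound
      value-matrix = trans (∑-cong (pairs d) λ {p} _ → cong (λ m → fromℕ m ℚ.* uncurry v p) (entry-matrix top (proj₁ p) (proj₂ p))) value-top
      -- A member of the orbit attaining the bound would equal `top` by `maximal⇒top`, applied to
      -- `topGraph` with its own edge count. Every other term thus has strictly larger valuation.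
      others : ∀ {M} → M ∈ orbit top → M ≢ matrix top → ℚ.- (bound ℚ.+ bound) ℚ.< ℚ.- (value (entry M) ℚ.+ value (entry M))
      others {M} M∈ M≢ = ℚₚ.neg-antimono-< (ℚₚ.≰⇒> λ le → M≢ (trans (sym (matrix-entry M)) (matrix-cong
        (Relabelling.maximal⇒top (entry M) (proj₁ (∈-orbit⁻ top M∈)) (proj₂ (∈-orbit⁻ top M∈)) (+-double-cancel-≤ le) ℕₚ.≤-refl))))
      ord-J : ord (J topGraph) ≡ just (ℚ.- (bound ℚ.+ bound))
      ord-J = ord-sum-dominant term (orbit top) (orbit-unique top) (matrix∈orbit top)
        (trans (ord-term (matrix top)) (cong (λ q → just (ℚ.- (q ℚ.+ q))) value-matrix))
        λ {M} M∈ M≢ → subst (ℚ.- (bound ℚ.+ bound) <∞_) (sym (ord-term M)) (others M∈ M≢)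
      A-value-top : A-value n topGraph (ℚ.- (bound ℚ.+ bound)) ≡ dₙ₊₁
      A-value-top = ℚₚ.≤-antisym
        (total-cancel-≤ (ℚₚ.≤-reflexive total≡)) (total-cancel-≤ (ℚₚ.≤-reflexive (sym total≡)))
        where
        total≡ : total (A-value n topGraph (ℚ.- (bound ℚ.+ bound))) ≡ total dₙ₊₁
        total≡ = +-double-injective (trans (sym (total-A-value (ℚ.- (bound ℚ.+ bound))))
          (trans (neg-involutive (bound ℚ.+ bound)) (cong₂ ℚ._+_ bound≡ bound≡)))

    -- Identification of the maximiser with the most edges.

    Conclusion : WGraph d → Set
    Conclusion G = (Σ (Permutation′ d) λ σ → ∀ i j → top i j ≡ w G (σ ⟨$⟩ʳ i) (σ ⟨$⟩ʳ j)) ×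
      (∃ λ q → dₙ₊₁ ≡ q × A n G ≡ just q)

    maximiser≅top : (G : WGraph d) → InCalG n G → (∀ H → InCalG n H → A n H ≤-∞ A n G) →
      (∀ H → InCalG n H → A n H ≡ A n G → numEdges (w H) ≤ numEdges (w G)) → Conclusion G
    maximiser≅top G G∈ maximal most-edges = from-cases (A-cases n G)
      where
      open Candidate G G∈
      d≤A : just dₙ₊₁ ≤-∞ A n G
      d≤A = subst (_≤-∞ A n G) A-topGraph (maximal topGraph topGraph∈)
      conclude : ∀ {o} → ord (J G) ≡ just o → A n G ≡ just (A-value n G o) → Conclusion G
      conclude {o} eq A≡ = let M , π , M≡ , le = dominant-relabelling eq in
        (π , λ i j → trans (sym (Relabelling.maximal⇒top M π M≡ (bound≤value le) edges i j)) (M≡ i j)) ,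
        dₙ₊₁ , refl , trans A≡ (cong just a≡d)
        where
        a≡d : A-value n G o ≡ dₙ₊₁
        a≡d = ℚₚ.≤-antisym (A≤dₙ₊₁ eq) (subst (just dₙ₊₁ ≤-∞_) A≡ d≤A)
        -- Both graphs have A equal to `dₙ₊₁`, so `topGraph` also attains the maximum and the choice
        -- of G compares their edge counts.
        edges : numEdges top ≤ numEdges (w G)
        edges = most-edges topGraph topGraph∈ (trans A-topGraph (trans (cong just (sym a≡d)) (sym A≡)))
        bound≤value : ∀ {q} → ℚ.- o ℚ.≤ q ℚ.+ q → bound ℚ.≤ q
        bound≤value {q} le = +-double-cancel-≤ (subst (ℚ._≤ q ℚ.+ q) (trans (total-A-value o)
          (trans (cong (λ a → total a ℚ.+ total a) a≡d) (sym (cong₂ ℚ._+_ bound≡ bound≡)))) le)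
      from-cases : (ord (J G) ≡ nothing × A n G ≡ nothing) ⊎
        (∃ λ o → ord (J G) ≡ just o × A n G ≡ just (A-value n G o)) → Conclusion G
      -- The value of A at G cannot be minus infinity, since the finite value at `topGraph` lies
      -- below it.
      from-cases (inj₁ (_ , A≡)) = ⊥-elim (subst (just dₙ₊₁ ≤-∞_) A≡ d≤A)
      from-cases (inj₂ (o , eq , A≡)) = conclude eq A≡

theorem3p8 : (S : Setting) (d : ℕ) (f : Data.List.List (Carrier (Setting.K S)))
    (x : Fin d → Carrier (Setting.Kbar S)) →
    Field.HasDegree (Setting.K S) f d →
    (∀ i j → x i ≡ x j → i ≡ j) →
    (∀ i → Field.eval (Setting.Kbar S) (map (Setting.ι S) f) (x i) ≡ Field.0# (Setting.Kbar S)) →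
    (n : ℕ) → n < Roots.k S x →
    (G : WGraph d) → Roots.InCalG S x n G →
    (∀ H → Roots.InCalG S x n H → Roots.A S x n H ≤-∞ Roots.A S x n G) →
    (∀ H → Roots.InCalG S x n H → Roots.A S x n H ≡ Roots.A S x n G →
    numEdges (w H) ≤ numEdges (w G)) →
    (Σ (Permutation′ d) λ σ → ∀ i j →
    Roots.wG S x (suc n) i j ≡ w G (σ ⟨$⟩ʳ i) (σ ⟨$⟩ʳ j))
    × (∃ λ (q : ℚ) → (Roots.dd S x (suc n) ≡ q) × (Roots.A S x n G ≡ just q))
theorem3p8 S d f x _ x-injective _ n n<k = Distinct.Rearrangement.maximiser≅top S x x-injective n n<k
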